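{- Let $(T,\preceq,\Sigma,\mathcal S,\mathcal M)$ be an $(\mathcal S,\mathcal M)$-tree. Then for every pair $n,k\in\omega$ and every colouring $\chi$ of $\mathcal{AM}^n_k$ with finitely many colours, there exists $F\in\mathcal M^n$ such that $\chi$ is constant on $\{F\circ g: g\in\mathcal{AM}^n_k\}$.
   Context: A tree is a partially ordered set $(T,\preceq)$ such that for every $a\in T$ the set $\{b\in T:b\prec a\}$ is finite and linearly ordered by $\preceq$. The level of $a$ is $\ell(a)=|\{b\in T:b\prec a\}|$; $T(n)=\{a\in T:\ell(a)=n\}$, and $T(\le n)$, $T(<n)$ are defined analogously. For $a\in T$ and $n\le \ell(a)$, $a|_n$ denotes the unique predecessor of $a$ at level $n$ (with $a|_{\ell(a)}=a$). A node $b$ is an immediate successor of $a$ if $a\prec b$ and there is no $c$ with $a\prec c\prec b$. An $\mathcal S$-tree is a quadruple $(T,\preceq,\Sigma,\mathcal S)$ where $(T,\preceq)$ is a countable tree in which every node has finitely many immediate successors and $T(0)$ is finite, $\Sigma$ is a set, and $\mathcal S\colon T\times T^{<\omega}\times\Sigma\to T$ is a partial function such that: (S1) if $\mathcal S(a,\bar p,c)$ is defined then it is an immediate successor of $a$ and every entry of $\bar p$ has level at most $\ell(a)-1$; (S2) if $\mathcal S(a,\bar p,c)=\mathcal S(b,\bar q,d)$ then $a=b$, $\bar p=\bar q$ and $c=d$; (S3) for every $a\in T$ and every immediate successor $b$ of $a$ there are $\bar p\in T^{<\omega}$ and $c\in\Sigma$ with $b=\mathcal S(a,\bar p,c)$.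 For $S\subseteq T$, a map $f\colon S\to T$ is level-preserving if $\ell(a)=\ell(b)$ implies $\ell(f(a))=\ell(f(b))$; then $\tilde f(n)$ denotes $\ell(f(a))$ for any $a\in S$ with $\ell(a)=n$. An injection $F\colon T\to T$ is shape-preserving if (i) it is level-preserving; (ii) whenever $\mathcal S(a,\bar p,c)$ is defined, $\mathcal S(F(a),F(\bar p),c)$ is defined and $\mathcal S(F(a),F(\bar p),c)\preceq F(\mathcal S(a,\bar p,c))$, where $F(\bar p)$ is the tuple of images of the entries of $\bar p$; (iii) for every $a\in T(0)$ and $b\in T$ with $a\preceq b$ we have $a\preceq F(b)$. For $S\subseteq T$, a map $f\colon S\to T$ is shape-preserving if it extends to a shape-preserving $F\colon T\to T$. A shape-preserving $F$ skips level $m$ if $m\notin\tilde F[\omega]$, and skips only level $m$ if $\tilde F[\omega]=\omega\setminus\{m\}$. An $(\mathcal S,\mathcal M)$-tree is a quintuple $(T,\preceq,\Sigma,\mathcal S,\mathcal M)$ where $(T,\preceq,\Sigma,\mathcal S)$ is an $\mathcal S$-tree and $\mathcal M$ is a set of shape-preserving functions $T\to T$ such that: (M1) $\mathrm{Id}_T\in\mathcal M$, $\mathcal M$ is closed under composition, and whenever $(F_i)_{i\in\omega}$ is a sequence in $\mathcal M$ with $F_i\restriction T(\le i)=F_{i+1}\restriction T(\le i)$ for all $i$, there is $F_\infty\in\mathcal M$ with $F_\infty\restriction T(\le i)=F_i\restriction T(\le i)$ for all $i$; (M2) for every $n\in\omega$ and every $F\in\mathcal M$ with $\tilde F(n)>0$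 which skips level $\tilde F(n)-1$, there are $F_1,F_2\in\mathcal M$ such that $F_2$ skips only level $\tilde F(n)-1$ and $(F_2\circ F_1)\restriction T(\le n)=F\restriction T(\le n)$; (M3) for all $n<m$ in $\omega$ there is $F^n_m\in\mathcal M$ skipping only level $m$ such that $F^n_m(b)=\mathcal S(b,\bar p,c)$ whenever $a\in T(n)$, $b\in T(m)$, $\bar p\in T^{<\omega}$, $c\in\Sigma$, $\mathcal S(a,\bar p,c)$ is defined and $\mathcal S(a,\bar p,c)\preceq b$. Notation: $\mathcal M^n=\{F\in\mathcal M: F\restriction T(<n)\text{ is the identity}\}$; $\mathcal{AM}=\{F\restriction T(<k): F\in\mathcal M,\ k>0\}$; $\mathcal{AM}^n_k=\{F\restriction T(<n+k):F\in\mathcal M^n\}$; $\mathcal{AM}^n_k(\le m)=\{f\in\mathcal{AM}^n_k:\tilde f(n+k-1)\le m\}$; $\mathcal{AM}^n_k(m)=\{f\in\mathcal{AM}^n_k:\tilde f(n+k-1)=m\}$. -}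

module Defs where

open import Data.Fin.Base using (Fin)
open import Data.List.Base using (List; length; map)
open import Data.List.Membership.Propositional using (_∈_)
open import Data.List.Relation.Unary.All using (All)
open import Data.List.Relation.Unary.Unique.Propositional using (Unique)
open import Data.Maybe.Base using (Maybe; just)
open import Data.Nat.Base using (ℕ; suc; _+_; _≤_; _<_)
open import Data.Product.Base using (Σ-syntax; ∃-syntax; _×_; _,_; proj₁)
open import Data.Sum.Base using (_⊎_)
open import Function.Base using (id; _∘_)
open import Function.Bundles using (_⇔_; _↣_; Func)
open import Function.Definitions using (Injective)
open import Level using (Level; _⊔_) renaming (suc to lsuc)
open import Relation.Binary.Bundles using (Setoid)
open import Relation.Binary.Core using (Rel)
open import Relation.Binary.PropositionalEquality
  using (_≡_; _≢_; _≗_; refl; sym; trans; cong; setoid)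
import Relation.Binary.Construct.NonStrictToStrict as ToStrict
open import Relation.Binary.Structures using (IsPartialOrder)
open import Relation.Nullary.Negation using (¬_)
open import Relation.Unary using (Pred)

-- The list enumerates P without repetitions, so its length is the
-- cardinality of P.
Finite : ∀ {a p} {A : Set a} → Pred A p → Set (a ⊔ p)
Finite {A = A} P = Σ[ xs ∈ List A ] Unique xs × (∀ x → x ∈ xs ⇔ P x)

card : ∀ {a p} {A : Set a} {P : Pred A p} → Finite P → ℕ
card (xs , _) = length xs

record Tree (a o : Level) : Set (lsuc (a ⊔ o)) where
  infix 4 _≼_
  field
    T              : Set a
    _≼_            : Rel T o
    isPartialOrder : IsPartialOrder _≡_ _≼_

  open ToStrict _≡_ _≼_ public using () renaming (_<_ to _≺_)

  field
    ≺-finite : ∀ a → Finite (_≺ a)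
    ≺-linear : ∀ a {b c} → b ≺ a → c ≺ a → b ≼ c ⊎ c ≼ b

  ℓ : T → ℕ
  ℓ a = card (≺-finite a)

  ImmediateSuccessor : T → T → Set (a ⊔ o)
  ImmediateSuccessor a b = a ≺ b × ¬ (∃[ c ] a ≺ c × c ≺ b)

  T⟨<_⟩ : ℕ → Set a
  T⟨< n ⟩ = Σ[ a ∈ T ] ℓ a < n

  LevelPreserving : (T → T) → Set a
  LevelPreserving F = ∀ {a b} → ℓ a ≡ ℓ b → ℓ (F a) ≡ ℓ (F b)

  -- F ˜ n ↦ j reads "F̃(n) = j".  It is a relation because F̃(n) is only
  -- meaningful when F is level-preserving and T(n) is inhabited.
  infix 4 _˜_↦_
  _˜_↦_ : (T → T) → ℕ → ℕ → Set a
  F ˜ n ↦ j = ∃[ a ] ℓ a ≡ n × ℓ (F a) ≡ j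

  _∈Range˜_ : ℕ → (T → T) → Set a
  j ∈Range˜ F = ∃[ n ] F ˜ n ↦ j

  Skips : (T → T) → ℕ → Set a
  Skips F m = ¬ (m ∈Range˜ F)

  SkipsOnly : (T → T) → ℕ → Set a
  SkipsOnly F m = ∀ j → j ∈Range˜ F ⇔ j ≢ m

record STree (a o s : Level) : Set (lsuc (a ⊔ o ⊔ s)) where
  field
    tree : Tree a o

  open Tree tree public

  field
    countable       : T ↣ ℕ
    finiteBranching : ∀ a → Finite (ImmediateSuccessor a)
    finiteRoots     : Finite (λ a → ℓ a ≡ 0)
    Sig             : Set s
    𝒮               : T → List T → Sig → Maybe T

  infix 4 𝒮⟨_,_,_⟩≃_
  𝒮⟨_,_,_⟩≃_ : T → List T → Sig → T → Set a
  𝒮⟨ a , p̄ , c ⟩≃ b = 𝒮 a p̄ c ≡ just b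

  field
    S1-successor : ∀ {a p̄ c b} → 𝒮⟨ a , p̄ , c ⟩≃ b → ImmediateSuccessor a b
    -- "level at most ℓ(a) - 1", with integer subtraction: p̄ is empty
    -- when ℓ(a) = 0.
    S1-levels    : ∀ {a p̄ c b} → 𝒮⟨ a , p̄ , c ⟩≃ b → All (λ q → ℓ q < ℓ a) p̄
    S2           : ∀ {a p̄ c b q̄ d e} → 𝒮⟨ a , p̄ , c ⟩≃ e → 𝒮⟨ b , q̄ , d ⟩≃ e →
                   a ≡ b × p̄ ≡ q̄ × c ≡ d
    S3           : ∀ {a b} → ImmediateSuccessor a b →
                   ∃[ p̄ ] ∃[ c ] 𝒮⟨ a , p̄ , c ⟩≃ b

  record ShapePreserving (F : T → T) : Set (a ⊔ o ⊔ s) where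
    field
      injective       : Injective _≡_ _≡_ F
      levelPreserving : LevelPreserving F
      preserves-𝒮     : ∀ {a p̄ c b} → 𝒮⟨ a , p̄ , c ⟩≃ b →
                        ∃[ b′ ] 𝒮⟨ F a , map F p̄ , c ⟩≃ b′ × b′ ≼ F b
      preserves-roots : ∀ {a b} → ℓ a ≡ 0 → a ≼ b → a ≼ F b

record SMTree (a o s m : Level) : Set (lsuc (a ⊔ o ⊔ s ⊔ m)) where
  field
    sTree : STree a o s

  open STree sTree public

  field
    𝓜                 : Pred (T → T) m
    -- 𝓜 is a set of functions, and functions are equal when they agree
    -- pointwise.
    𝓜-resp-≗          : ∀ {F G} → F ≗ G → 𝓜 F → 𝓜 G
    𝓜-shapePreserving : ∀ {F} → 𝓜 F → ShapePreserving F

    M1-id    : 𝓜 id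
    M1-∘     : ∀ {F G} → 𝓜 F → 𝓜 G → 𝓜 (F ∘ G)
    M1-limit : (F : ℕ → T → T) → (∀ i → 𝓜 (F i)) →
               (∀ i a → ℓ a ≤ i → F i a ≡ F (suc i) a) →
               ∃[ F∞ ] 𝓜 F∞ × (∀ i a → ℓ a ≤ i → F∞ a ≡ F i a)

    -- Here F̃(n) = suc l, so that F̃(n) > 0 and l = F̃(n) - 1.
    M2 : ∀ n l F → 𝓜 F → F ˜ n ↦ suc l → Skips F l →
         ∃[ F₁ ] ∃[ F₂ ] 𝓜 F₁ × 𝓜 F₂ × SkipsOnly F₂ l ×
           (∀ a → ℓ a ≤ n → F₂ (F₁ a) ≡ F a)

    M3 : ∀ n m → n < m →
         ∃[ F ] 𝓜 F × SkipsOnly F m ×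
           (∀ {a b p̄ c d} → ℓ a ≡ n → ℓ b ≡ m →
            𝒮⟨ a , p̄ , c ⟩≃ d → d ≼ b → 𝒮⟨ b , p̄ , c ⟩≃ F b)

  𝓜^ : ℕ → Pred (T → T) (a ⊔ m)
  𝓜^ n F = 𝓜 F × (∀ a → ℓ a < n → F a ≡ a)

  -- Elements are maps on T(< n + k) together with a witness that they are
  -- restrictions of members of 𝓜^ n; equality ignores the witness.
  𝓐𝓜 : ℕ → ℕ → Setoid (a ⊔ m) a
  𝓐𝓜 n k = record
    { Carrier       = Σ[ g ∈ (T⟨< n + k ⟩ → T) ]
                        ∃[ G ] 𝓜^ n G × (∀ x → g x ≡ G (proj₁ x))
    ; _≈_           = λ g h → proj₁ g ≗ proj₁ h
    ; isEquivalence = record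
      { refl  = λ _ → refl
      ; sym   = λ e x → sym (e x)
      ; trans = λ e e′ x → trans (e x) (e′ x)
      }
    }

  𝓜^-∘ : ∀ {n F G} → 𝓜^ n F → 𝓜^ n G → 𝓜^ n (F ∘ G)
  𝓜^-∘ {F = F} (F∈ , F-id) (G∈ , G-id) =
    M1-∘ F∈ G∈ , λ a a<n → trans (cong F (G-id a a<n)) (F-id a a<n)

  compose : ∀ {n k F} → 𝓜^ n F → Setoid.Carrier (𝓐𝓜 n k) → Setoid.Carrier (𝓐𝓜 n k)
  compose {F = F} F∈ (g , G , G∈ , g≡G) =
    F ∘ g , F ∘ G , 𝓜^-∘ F∈ G∈ , λ x → cong F (g≡G x)

  Colouring : ℕ → ℕ → ℕ → Set (a ⊔ m)
  Colouring n k r = Func (𝓐𝓜 n k) (setoid (Fin r))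

{-# OPTIONS --safe #-}
module Submission where

-- Fusion along (M1) reduces the theorem to k = 1: it yields F ∈ 𝓜ⁿ such that
-- χ(F ∘ g) depends only on g below level n + k - 1, because by (M2) all one-level
-- extensions of a given map factor through the smallest one.
--
-- For k = 1 pass to a colour that is large, i.e. met by K ∘ g for every K ∈ 𝓜ⁿ and
-- some g, and build F one level at a time, keeping large the set of admissible
-- continuations.  If a step is impossible, fusion produces a map along which no
-- one-step configuration has the colour; but largeness and a second fusion give
-- finitely many maps e such that every K can be followed by some e to reach the
-- colour.  Colour words by the e that works for them, letting letters act through
-- the copying maps of (M3).  A form of the Hales-Jewett theorem in which the line
-- also agrees with its constant prefix then provides a one-step configuration.

-- The obstacle is that (M3) only repeats, on all branches at once, the letters they have at one
-- common earlier level, while a map may add unrelated letters to different branches. Richness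
-- removes it: up to a given level there are finitely many one-step maps, and their composite places
-- the letters of each of them at a common level of the image. After a rich map every one-step move
-- is thus a `copy` of some level, and an induction step has to control finitely many copies. A
-- one-step configuration is a rich `G` that has the property together with every `G ∘ copy i`. When
-- `G` is built from a variable word, its action up to level n sees only the letters before the
-- first variable, whereas `G ∘ copy i` sees the whole word with i substituted. The Hales-Jewett
-- theorem alone gives the second half; agreement with the prefix gives the first.

open import Defs
open import Axiom.ExcludedMiddle using (ExcludedMiddle)
open import Data.Empty using (⊥-elim)
open import Data.Fin.Base using (Fin; toℕ; fromℕ<; funToFin; finToFun)
open import Data.Fin.Properties using (finToFun-funToFin; toℕ<n; toℕ-fromℕ<) renaming (_≟_ to _≟ᶠ_)
open import Data.List.Base
  using (List; []; _∷_; _++_; map; length; lookup; allFin; concatMap; cartesianProductWith)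
open import Data.List.Membership.Propositional using (_∈_; find; lose)
open import Data.List.Membership.Propositional.Properties
  using (∈-∃++; ∈-++⁻; ∈-++⁺ˡ; ∈-++⁺ʳ; ∈-allFin; ∈-lookup; ∈-concatMap⁺; ∈-concatMap⁻; ∈-cartesianProductWith⁺)
open import Data.List.Properties
  using (++-assoc; map-++; map-∘; map-id; map-cong-local; length-++; length-map; length-tabulate)
open import Data.List.Relation.Unary.All as All using (All; []; _∷_)
open import Data.List.Relation.Unary.All.Properties as AllP using (¬Any⇒All¬)
open import Data.List.Relation.Unary.AllPairs using ([]; _∷_)
open import Data.List.Relation.Unary.Any as Any using (here; there; any?)
open import Data.List.Relation.Unary.Any.Properties using (lookup-index)
open import Data.List.Relation.Unary.Unique.Propositional using (Unique)
open import Data.Maybe.Base using (Maybe; just; nothing; fromMaybe)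
open import Data.Maybe.Properties using (just-injective)
open import Data.Nat.Base using (ℕ; zero; suc; _+_; _^_; _≤_; _<_; z≤n; s≤s; s≤s⁻¹)
open import Data.Nat.Induction using (<-rec)
open import Data.Nat.Properties
open import Data.Product.Base using (Σ-syntax; ∃-syntax; _×_; _,_; proj₁; proj₂)
open import Data.Sum.Base using (_⊎_; inj₁; inj₂)
open import Function.Base using (id; _∘_; case_of_)
open import Function.Bundles using (Equivalence; Func)
open import Level using (Level; _⊔_; Lift; lift; lower)
open import Relation.Binary.Bundles using (Setoid)
open import Relation.Binary.Definitions using (tri<; tri≈; tri>)
open import Relation.Binary.PropositionalEquality
  using (_≡_; _≢_; _≗_; refl; sym; trans; cong; subst; subst₂; module ≡-Reasoning)
open import Relation.Binary.Structures using (IsPartialOrder)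
open import Relation.Nullary using (¬_; Dec; yes; no)
open import Relation.Nullary.Decidable using (map′; decidable-stable)

-- Words over a finite alphabet

Unique-⊆⇒length≤ : ∀ {a} {A : Set a} {xs ys : List A} → Unique xs →
                   (∀ {x} → x ∈ xs → x ∈ ys) → length xs ≤ length ys
Unique-⊆⇒length≤ {xs = []} _ _ = z≤n
Unique-⊆⇒length≤ {xs = x ∷ xs} (x∉xs ∷ uxs) ⊆ys
  with ys₁ , ys₂ , refl ← ∈-∃++ (⊆ys (here refl)) = begin
  suc (length xs)              ≤⟨ s≤s (Unique-⊆⇒length≤ uxs ⊆rest) ⟩
  suc (length (ys₁ ++ ys₂))    ≡⟨ cong suc (length-++ ys₁) ⟩
  suc (length ys₁ + length ys₂) ≡⟨ +-suc _ _ ⟨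
  length ys₁ + suc (length ys₂) ≡⟨ length-++ ys₁ ⟨
  length (ys₁ ++ x ∷ ys₂)      ∎
  where
  open ≤-Reasoning
  ⊆rest : ∀ {y} → y ∈ xs → y ∈ ys₁ ++ ys₂
  ⊆rest y∈xs with ∈-++⁻ ys₁ (⊆ys (there y∈xs))
  ... | inj₁ y∈₁           = ∈-++⁺ˡ y∈₁
  ... | inj₂ (here refl)   = ⊥-elim (All.lookup x∉xs y∈xs refl)
  ... | inj₂ (there y∈₂)   = ∈-++⁺ʳ ys₁ y∈₂

Unique-Fin⇒length≤ : ∀ {n} {xs : List (Fin n)} → Unique xs → length xs ≤ n
Unique-Fin⇒length≤ {n} {xs} uxs =
  subst (length xs ≤_) (length-tabulate {n = n} id) (Unique-⊆⇒length≤ uxs (λ {x} _ → ∈-allFin x))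

module Words {A : Set} (letters : List A) (complete : ∀ x → x ∈ letters) where

  -- In a variable word, `nothing` is the variable.
  infix 8 _[_]
  _[_] : List (Maybe A) → A → List A
  v [ x ] = map (fromMaybe x) v

  const-[] : ∀ u {x} → map just u [ x ] ≡ u
  const-[] u = trans (sym (map-∘ u)) (map-id u)

  ++-[] : ∀ u v {x} → (u ++ v) [ x ] ≡ u [ x ] ++ v [ x ]
  ++-[] u v = map-++ _ u v

  record Line : Set where
    constructor _∙_
    field
      prefix : List A
      tail   : List (Maybe A)

    size : ℕ
    size = suc (length prefix + length tail)

    word : List (Maybe A)
    word = map just prefix ++ nothing ∷ tail

  open Line

  infix 8 _⟨_⟩
  _⟨_⟩ : Line → A → List A
  L ⟨ x ⟩ = prefix L ++ x ∷ tail L [ x ]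

  word-[] : ∀ L {x} → word L [ x ] ≡ L ⟨ x ⟩
  word-[] L {x} = trans (++-[] (map just (prefix L)) _) (cong (_++ x ∷ tail L [ x ]) (const-[] (prefix L)))

  length-⟨⟩ : ∀ L {x} → length (L ⟨ x ⟩) ≡ size L
  length-⟨⟩ L = trans (length-++ (prefix L))
    (trans (+-suc _ _) (cong (λ n → suc (length (prefix L) + n)) (length-map _ (tail L))))

  length-word : ∀ L → length (word L) ≡ size L
  length-word L = trans (length-++ (map just (prefix L)))
    (trans (+-suc _ _) (cong (λ n → suc (n + length (tail L))) (length-map just (prefix L))))

  infixr 5 _◂_ _▸_
  _◂_ : List A → Line → Line
  u ◂ (p ∙ t) = (u ++ p) ∙ t

  _▸_ : Line → List (Maybe A) → Line
  (p ∙ t) ▸ v = p ∙ (t ++ v)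

  ◂-⟨⟩ : ∀ u L {x} → (u ◂ L) ⟨ x ⟩ ≡ u ++ L ⟨ x ⟩
  ◂-⟨⟩ u L = ++-assoc u (prefix L) _

  ▸-⟨⟩ : ∀ L v {x} → (L ▸ v) ⟨ x ⟩ ≡ L ⟨ x ⟩ ++ v [ x ]
  ▸-⟨⟩ L v {x} = trans (cong (λ w → prefix L ++ x ∷ w) (++-[] (tail L) v))
    (sym (++-assoc (prefix L) (x ∷ tail L [ x ]) (v [ x ])))

  size-◂ : ∀ u L → size (u ◂ L) ≡ length u + size L
  size-◂ u L = trans (cong (λ n → suc (n + length (tail L))) (length-++ u))
    (trans (cong suc (+-assoc (length u) _ _)) (sym (+-suc (length u) _)))

  size-▸ : ∀ L v → size (L ▸ v) ≡ size L + length v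
  size-▸ L v = cong suc (trans (cong (length (prefix L) +_) (length-++ (tail L)))
    (sym (+-assoc (length (prefix L)) _ _)))

  length-prefix≤size : ∀ L → length (prefix L) ≤ size L
  length-prefix≤size L = m≤n⇒m≤1+n (m≤m+n _ _)

  wordsUpTo : ℕ → List (List A)
  wordsUpTo zero    = [] ∷ []
  wordsUpTo (suc N) = [] ∷ cartesianProductWith _∷_ letters (wordsUpTo N)

  ∈-wordsUpTo : ∀ {N} w → length w ≤ N → w ∈ wordsUpTo N
  ∈-wordsUpTo {zero}  []      _         = here refl
  ∈-wordsUpTo {suc N} []      _         = here refl
  ∈-wordsUpTo {suc N} (x ∷ w) (s≤s w≤N) =
    there (∈-cartesianProductWith⁺ _∷_ (complete x) (∈-wordsUpTo w w≤N))

  -- The variable ranges over `B` only, while words are over all of `A`; induction on the alphabet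
  -- thus becomes induction on a list.
  ConstantOn : ∀ {s} → List A → (List A → Fin s) → Line → Set
  ConstantOn B c L = ∀ {x y} → x ∈ B → y ∈ B → c (L ⟨ x ⟩) ≡ c (L ⟨ y ⟩)

  MonoLine : ∀ {s} → List A → ℕ → (List A → Fin s) → Set
  MonoLine B N c = Σ[ L ∈ Line ] size L ≤ N × ConstantOn B c L

  HalesJewett : List A → Set
  HalesJewett B = ∀ s → ∃[ N ] ∀ (c : List A → Fin s) → MonoLine B N c

  TailHalesJewett : List A → Set
  TailHalesJewett B = ∀ s M → ∃[ N ] ∀ (c : List A → Fin s) → Σ[ L ∈ Line ] size L ≤ N ×
    (∀ u → length u ≤ M → ConstantOn B (λ w → c (w ++ u)) L)

  -- A word is coloured by the table of the colours of its extensions by words of length at most M,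
  -- so that one line serves all extensions at once.
  HJ⇒tailHJ : ∀ {B} → HalesJewett B → TailHalesJewett B
  HJ⇒tailHJ {B} hj s M = proj₁ (hj _) , colour
    where
    us = wordsUpTo M
    colour : (c : List A → Fin s) → Σ[ L ∈ Line ] size L ≤ proj₁ (hj _) ×
             (∀ u → length u ≤ M → ConstantOn B (λ w → c (w ++ u)) L)
    colour c with L , size≤ , const ← proj₂ (hj (s ^ length us)) (λ w → funToFin (λ i → c (w ++ lookup us i)))
      = L , size≤ , λ u u≤M {x} {y} x∈B y∈B →
        let u∈ = ∈-wordsUpTo u u≤M
            i  = Any.index u∈
            at : ∀ w → finToFun (funToFin (λ i → c (w ++ lookup us i))) i ≡ c (w ++ u)
            at w = trans (finToFun-funToFin (λ i → c (w ++ lookup us i)) i)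
                         (cong (λ v → c (w ++ v)) (sym (lookup-index u∈)))
        in trans (sym (at (L ⟨ x ⟩))) (trans (cong (λ f → finToFun f i) (const x∈B y∈B)) (at (L ⟨ y ⟩)))

  module Focusing (z x₀ : A) (B : List A) (tailHJ : TailHalesJewett (x₀ ∷ B)) (s : ℕ) where

    -- With as many lines as colours, one of them has the colour of the focus and is
    -- therefore monochromatic on z as well.
    record Focused (t N : ℕ) (c : List A → Fin s) : Set where
      field
        focus    : List A
        entries  : List (Line × Fin s)
        number   : length entries ≡ t
        focus≤   : length focus ≤ N
        sound    : All (λ (L , d) → size L ≤ N × L ⟨ z ⟩ ≡ focus ×
                         (∀ {x} → x ∈ x₀ ∷ B → c (L ⟨ x ⟩) ≡ d)) entries
        distinct : Unique (c focus ∷ map proj₂ entries)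

    focusing : ∀ t → ∃[ N ] ∀ c → MonoLine (z ∷ x₀ ∷ B) N c ⊎ Focused t N c
    focusing zero    = 0 , λ c → inj₂ record
      { focus = [] ; entries = [] ; number = refl ; focus≤ = z≤n ; sound = [] ; distinct = [] ∷ [] }
    focusing (suc t) with M , step ← focusing t with K , pick ← tailHJ s M = K + M , λ c → go c (pick c)
      where
      go : ∀ c → (Σ[ L ∈ Line ] size L ≤ K × (∀ u → length u ≤ M → ConstantOn (x₀ ∷ B) (λ w → c (w ++ u)) L)) →
           MonoLine (z ∷ x₀ ∷ B) (K + M) c ⊎ Focused (suc t) (K + M) c
      -- `x₀` stands for every letter of `x₀ ∷ B`: before a tail of length at most M, `L` gives them
      -- all the same colour.
      go c (L , L≤K , const) with step (λ u → c (L ⟨ x₀ ⟩ ++ u))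
      ... | inj₁ (L′ , L′≤M , const′) = inj₁
        ( L ⟨ x₀ ⟩ ◂ L′
        , subst (_≤ K + M) (sym (size-◂ (L ⟨ x₀ ⟩) L′)) (+-mono-≤ (subst (_≤ K) (sym (length-⟨⟩ L)) L≤K) L′≤M)
        , λ x∈ y∈ → trans (cong c (◂-⟨⟩ _ L′)) (trans (const′ x∈ y∈) (sym (cong c (◂-⟨⟩ _ L′)))))
      ... | inj₂ foc = result
        where
        open Focused foc
        c′ = λ u → c (L ⟨ x₀ ⟩ ++ u)
        focus′ = L ⟨ z ⟩ ++ focus
        -- The old focus becomes a constant tail of `L`, and each old line is moved together with
        -- `L` by the same variable. All of them send `z` to `focus′`.
        entries′ = (L ▸ map just focus , c′ focus) ∷ map (λ (L′ , d) → L ▸ word L′ , d) entries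
        colours≡ : map proj₂ entries′ ≡ c′ focus ∷ map proj₂ entries
        colours≡ = cong (c′ focus ∷_) (sym (map-∘ entries))
        Sound = λ (L , d) → size L ≤ K + M × L ⟨ z ⟩ ≡ focus′ × (∀ {x} → x ∈ x₀ ∷ B → c (L ⟨ x ⟩) ≡ d)
        sound′ : All Sound entries′
        sound′ = ( subst (_≤ K + M) (sym (size-▸ L _)) (+-mono-≤ L≤K (subst (_≤ M) (sym (length-map just focus)) focus≤))
                 , trans (▸-⟨⟩ L _) (cong (L ⟨ z ⟩ ++_) (const-[] focus))
                 , λ {x} x∈ → trans (cong c (trans (▸-⟨⟩ L _) (cong (L ⟨ x ⟩ ++_) (const-[] focus))))
                                    (const focus focus≤ x∈ (here refl)))
               ∷ AllP.map⁺ (All.map extend sound)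
          where
          extend : ∀ {e} → (size (proj₁ e) ≤ M × proj₁ e ⟨ z ⟩ ≡ focus × (∀ {x} → x ∈ x₀ ∷ B → c′ (proj₁ e ⟨ x ⟩) ≡ proj₂ e)) →
                   Sound (L ▸ word (proj₁ e) , proj₂ e)
          extend {L′ , d} (L′≤M , L′z , L′x) =
              subst (_≤ K + M) (sym (size-▸ L _)) (+-mono-≤ L≤K (subst (_≤ M) (sym (length-word L′)) L′≤M))
            , trans (▸-⟨⟩ L _) (cong (L ⟨ z ⟩ ++_) (trans (word-[] L′) L′z))
            , λ {x} x∈ → trans (cong c (trans (▸-⟨⟩ L _) (cong (L ⟨ x ⟩ ++_) (word-[] L′))))
                (trans (const (L′ ⟨ x ⟩) (subst (_≤ M) (sym (length-⟨⟩ L′)) L′≤M) x∈ (here refl)) (L′x x∈))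
        result : MonoLine (z ∷ x₀ ∷ B) (K + M) c ⊎ Focused (suc t) (K + M) c
        result with any? (λ e → c focus′ ≟ᶠ proj₂ e) entries′
        ... | yes found with (L′ , d) , L′∈ , eq ← find found
                        with L′≤ , L′z , L′x ← All.lookup sound′ L′∈ = inj₁ (L′ , L′≤ , λ x∈ y∈ → trans (at x∈) (sym (at y∈)))
          where
          at : ∀ {x} → x ∈ z ∷ x₀ ∷ B → c (L′ ⟨ x ⟩) ≡ c focus′
          at (here refl) = cong c L′z
          at (there x∈)  = trans (L′x x∈) (sym eq)
        ... | no notFound = inj₂ record
          { focus = focus′ ; entries = entries′ ; number = cong suc (trans (length-map _ entries) number)
          ; focus≤ = subst (_≤ K + M) (sym (length-++ (L ⟨ z ⟩)))
                       (+-mono-≤ (subst (_≤ K) (sym (length-⟨⟩ L)) L≤K) focus≤)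
          ; sound = sound′
          ; distinct = AllP.map⁺ (¬Any⇒All¬ entries′ notFound) ∷ subst Unique (sym colours≡) distinct }


  halesJewett : ∀ B → HalesJewett B
  halesJewett []           s = 1 , λ c → [] ∙ [] , s≤s z≤n , λ ()
  halesJewett (z ∷ [])     s = 1 , λ c → [] ∙ [] , s≤s z≤n , λ { (here refl) (here refl) → refl }
  halesJewett (z ∷ x₀ ∷ B) s
    with N , step ← Focusing.focusing z x₀ B (HJ⇒tailHJ (halesJewett (x₀ ∷ B))) s s = N , λ c → mono (step c)
    where
    open Focusing z x₀ B (HJ⇒tailHJ (halesJewett (x₀ ∷ B))) s
    mono : ∀ {N c} → MonoLine (z ∷ x₀ ∷ B) N c ⊎ Focused s N c → MonoLine (z ∷ x₀ ∷ B) N c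
    mono (inj₁ L)   = L
    mono (inj₂ foc) = ⊥-elim (1+n≰n (subst (λ n → suc n ≤ s) (trans (length-map _ entries) number) (Unique-Fin⇒length≤ distinct)))
      where open Focused foc

  -- A line that also has the colour of its constant prefix: the word obtained
  -- by stopping at the first occurrence of the variable.
  StoppedLine : ∀ {s} → (List A → Fin s) → Set
  StoppedLine c = Σ[ L ∈ Line ] ∀ x → c (L ⟨ x ⟩) ≡ c (prefix L)

  module Stopping (x₀ : A) (s : ℕ) where

    record Rainbow (t N : ℕ) (c : List A → Fin s) : Set where
      field
        entries  : List (List (Maybe A) × Fin s)
        number   : length entries ≡ t
        sound    : All (λ (v , d) → length v ≤ N × ∀ x → c (v [ x ]) ≡ d) entries
        distinct : Unique (map proj₂ entries)

    -- A line `L` whose colour survives tails is put before the words already found. If its prefix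
    -- has one of their colours, `L ▸ v` is a stopped line; otherwise the prefix contributes a new
    -- colour. With `t` above `s` only the first outcome remains.
    rainbow : ∀ t → ∃[ N ] ∀ c → StoppedLine c ⊎ Rainbow t N c
    rainbow zero = 0 , λ c → inj₂ record { entries = [] ; number = refl ; sound = [] ; distinct = [] }
    rainbow (suc t) with M , step ← rainbow t with K , pick ← HJ⇒tailHJ (halesJewett letters) s M = K + M , λ c → go c (pick c)
      where
      go : ∀ c → (Σ[ L ∈ Line ] size L ≤ K × (∀ u → length u ≤ M → ConstantOn letters (λ w → c (w ++ u)) L)) →
           StoppedLine c ⊎ Rainbow (suc t) (K + M) c
      go c (L , L≤K , const) with step (λ u → c (L ⟨ x₀ ⟩ ++ u))
      ... | inj₁ (L′ , L′-stop) =
        inj₁ (L ⟨ x₀ ⟩ ◂ L′ , λ x → trans (cong c (◂-⟨⟩ _ L′)) (L′-stop x))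
      ... | inj₂ rb = result
        where
        open Rainbow rb
        colour : ∀ {e} → e ∈ entries → ∀ x → c (L ⟨ x ⟩ ++ proj₁ e [ x ]) ≡ proj₂ e
        colour {v , d} e∈ x with v≤M , v-d ← All.lookup sound e∈ =
          trans (const (v [ x ]) (subst (_≤ M) (sym (length-map _ v)) v≤M) (complete x) (complete x₀)) (v-d x)
        result : StoppedLine c ⊎ Rainbow (suc t) (K + M) c
        result with any? (λ e → c (prefix L) ≟ᶠ proj₂ e) entries
        ... | yes found with (v , d) , v∈ , eq ← find found =
          inj₁ (L ▸ v , λ x → trans (cong c (▸-⟨⟩ L v)) (trans (colour v∈ x) (sym eq)))
        ... | no notFound = inj₂ record
          { entries  = (map just (prefix L) , c (prefix L)) ∷ map (λ (v , d) → word L ++ v , d) entries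
          ; number   = cong suc (trans (length-map _ entries) number)
          ; sound    = ( ≤-trans (subst (_≤ K) (sym (length-map just (prefix L))) (≤-trans (length-prefix≤size L) L≤K)) (m≤m+n K M)
                       , λ x → cong c (const-[] (prefix L)))
                     ∷ AllP.map⁺ (All.tabulate λ {(v , d)} e∈ →
                         subst (_≤ K + M) (sym (trans (length-++ (word L)) (cong (_+ length v) (length-word L))))
                               (+-mono-≤ L≤K (proj₁ (All.lookup sound e∈)))
                       , λ x → trans (cong c (trans (++-[] (word L) v) (cong (_++ v [ x ]) (word-[] L)))) (colour e∈ x))
          ; distinct = AllP.map⁺ (AllP.map⁺ (¬Any⇒All¬ entries notFound)) ∷ subst Unique (map-∘ entries) distinct
          }

  inhabited? : (xs : List A) → (∀ x → x ∈ xs) → A ⊎ ¬ A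
  inhabited? []      all∈ = inj₂ λ x → case all∈ x of λ ()
  inhabited? (x ∷ _) _    = inj₁ x

  stoppedLine : ∀ {s} (c : List A → Fin s) → StoppedLine c
  stoppedLine {s} c with inhabited? letters complete
  ... | inj₂ ¬A = [] ∙ [] , λ x → ⊥-elim (¬A x)
  ... | inj₁ x₀ with N , step ← Stopping.rainbow x₀ s (suc s) with step c
  ...   | inj₁ L  = L
  ...   | inj₂ rb = ⊥-elim (1+n≰n (subst (_≤ s) (trans (length-map _ entries) number) (Unique-Fin⇒length≤ distinct)))
    where open Stopping.Rainbow rb

-- Levels of a tree

maxBy : ∀ {a} {A : Set a} (f : A → ℕ) x xs → ∃[ y ] y ∈ x ∷ xs × (∀ {z} → z ∈ x ∷ xs → f z ≤ f y)
maxBy f x [] = x , here refl , λ { (here refl) → ≤-refl }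
maxBy f x (x′ ∷ xs) with y , y∈ , y-max ← maxBy f x′ xs with ≤-total (f x) (f y)
... | inj₁ fx≤ = y , there y∈ , λ { (here refl) → fx≤ ; (there z∈) → y-max z∈ }
... | inj₂ fy≤ = x , here refl , λ { (here refl) → ≤-refl ; (there z∈) → ≤-trans (y-max z∈) fy≤ }

module StrictlyIncreasing (f : ℕ → ℕ) (f-< : ∀ {i j} → i < j → f i < f j) where

  f-≤ : ∀ {i j} → i ≤ j → f i ≤ f j
  f-≤ i≤j with m≤n⇒m<n∨m≡n i≤j
  ... | inj₁ i<j  = <⇒≤ (f-< i<j)
  ... | inj₂ refl = ≤-refl

  f-injective : ∀ {i j} → f i ≡ f j → i ≡ j
  f-injective {i} {j} eq with <-cmp i j
  ... | tri< i<j _ _ = ⊥-elim (<⇒≢ (f-< i<j) eq)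
  ... | tri≈ _ i≡j _ = i≡j
  ... | tri> _ _ j<i = ⊥-elim (>⇒≢ (f-< j<i) eq)

  ≤f : ∀ n → n ≤ f n
  ≤f zero    = z≤n
  ≤f (suc n) = ≤-<-trans (≤f n) (f-< ≤-refl)

  module Skipping (l : ℕ) (skips : ∀ n → f n ≢ l) (attains : ∀ {j} → j ≢ l → ∃[ n ] f n ≡ j) where

    below : ∀ j → j < l → f j ≡ j
    below = <-rec _ λ j ih j<l → case attains (<⇒≢ j<l) of λ (i , fi≡j) →
      case m≤n⇒m<n∨m≡n (subst (i ≤_) fi≡j (≤f i)) of λ where
        (inj₂ refl) → fi≡j
        (inj₁ i<j)  → ⊥-elim (<⇒≢ i<j (trans (sym (ih i<j (<-trans i<j j<l))) fi≡j))

    l<f : ∀ d → l + d < f (l + d)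
    l<f zero    rewrite +-identityʳ l = ≤∧≢⇒< (≤f l) (skips l ∘ sym)
    l<f (suc d) rewrite +-suc l d = ≤-<-trans (l<f d) (f-< ≤-refl)

    above : ∀ d → f (l + d) ≡ suc l + d
    above = <-rec _ λ d ih → case attains {suc l + d} (>⇒≢ (s≤s (m≤m+n l d))) of λ (i , fi≡) →
      case <-cmp i (l + d) of λ where
        (tri≈ _ refl _) → fi≡
        (tri> _ _ i>)   → ⊥-elim (<⇒≱ (f-< i>) (subst (_≤ f (l + d)) (sym fi≡) (l<f d)))
        (tri< i< _ _)   → case ≤-total l i of λ where
          (inj₁ l≤i) → case m≤n⇒∃[o]m+o≡n l≤i of λ where
            (e , refl) → ⊥-elim (<⇒≢ (s≤s i<) (trans (sym (ih (+-cancelˡ-< l e d i<))) fi≡))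
          (inj₂ i≤l) → case m≤n⇒m<n∨m≡n i≤l of λ where
            (inj₁ i<l)  → ⊥-elim (<⇒≢ (<-trans i< ≤-refl) (trans (sym (below i i<l)) fi≡))
            (inj₂ refl) → ⊥-elim (<⇒≢ (s≤s i<) (trans (sym (trans (cong f (sym (+-identityʳ l))) (trans (ih (+-cancelˡ-< l 0 d (subst (_< l + d) (sym (+-identityʳ l)) i<))) (cong suc (+-identityʳ l))))) fi≡))

-- ExcludedMiddle (q ⊔ L) is ExcludedMiddle L whenever q is at most L.
decide : ∀ {q L} → ExcludedMiddle (q ⊔ L) → (P : Set q) → Dec P
decide {L = L} em P = map′ lower lift (em {Lift L P})

module Levels {a o s : Level} (S : STree a o s) {m} (em : ExcludedMiddle (a ⊔ o ⊔ s ⊔ m)) where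

  open STree S public
  open IsPartialOrder isPartialOrder public using ()
    renaming (refl to ≼-refl; trans to ≼-trans; antisym to ≼-antisym)

  ≺-trans : ∀ {x y z} → x ≺ y → y ≺ z → x ≺ z
  ≺-trans {x} {y} {z} (x≼y , x≢y) (y≼z , y≢z) =
    ≼-trans x≼y y≼z , λ { refl → y≢z (≼-antisym y≼z x≼y) }

  _≟ᵀ_ : (x y : T) → Dec (x ≡ y)
  x ≟ᵀ y = decide {L = o ⊔ s ⊔ m} em (x ≡ y)

  preds : T → List T
  preds x = proj₁ (≺-finite x)

  ∈preds⇒≺ : ∀ {x y} → y ∈ preds x → y ≺ x
  ∈preds⇒≺ {x} {y} = Equivalence.to (proj₂ (proj₂ (≺-finite x)) y)

  ≺⇒∈preds : ∀ {x y} → y ≺ x → y ∈ preds x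
  ≺⇒∈preds {x} {y} = Equivalence.from (proj₂ (proj₂ (≺-finite x)) y)

  Unique-∷preds : ∀ x → Unique (x ∷ preds x)
  Unique-∷preds x = All.tabulate (λ y∈ x≡y → proj₂ (∈preds⇒≺ {x} y∈) (sym x≡y)) ∷ proj₁ (proj₂ (≺-finite x))

  ℓ-≺ : ∀ {x y} → x ≺ y → ℓ x < ℓ y
  ℓ-≺ {x} {y} x≺y = Unique-⊆⇒length≤ (Unique-∷preds x) λ where
    (here refl) → ≺⇒∈preds x≺y
    (there z∈)  → ≺⇒∈preds (≺-trans (∈preds⇒≺ z∈) x≺y)

  ≼∧ℓ≡⇒≡ : ∀ {x y} → x ≼ y → ℓ x ≡ ℓ y → x ≡ y
  ≼∧ℓ≡⇒≡ {x} {y} x≼y ℓ≡ with x ≟ᵀ y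
  ... | yes x≡y = x≡y
  ... | no x≢y  = ⊥-elim (<⇒≢ (ℓ-≺ (x≼y , x≢y)) ℓ≡)

  ≺⇒≼-pred : ∀ {x p y} → ImmediateSuccessor p y → x ≺ y → x ≼ p
  ≺⇒≼-pred {x} {p} {y} (p≺y , none) x≺y with ≺-linear y x≺y p≺y
  ... | inj₁ x≼p = x≼p
  ... | inj₂ p≼x with p ≟ᵀ x
  ...   | yes refl = ≼-refl
  ...   | no p≢x   = ⊥-elim (none (x , (p≼x , p≢x) , x≺y))

  ℓ-successor : ∀ {x y} → ImmediateSuccessor x y → ℓ y ≡ suc (ℓ x)
  ℓ-successor {x} {y} y>x@(x≺y , _) = ≤-antisym
    (Unique-⊆⇒length≤ (proj₁ (proj₂ (≺-finite y))) ⊆preds) (ℓ-≺ x≺y)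
    where
    ⊆preds : ∀ {z} → z ∈ preds y → z ∈ x ∷ preds x
    ⊆preds {z} z∈ with z ≟ᵀ x
    ... | yes refl = here refl
    ... | no z≢x   = there (≺⇒∈preds (≺⇒≼-pred y>x (∈preds⇒≺ z∈) , z≢x))

  predecessor : ∀ {n} y → ℓ y ≡ suc n → ∃[ x ] ImmediateSuccessor x y
  predecessor y ℓy≡ with preds y | ∈preds⇒≺ {y} | ≺⇒∈preds {y}
  ... | x₀ ∷ xs | ∈⇒≺ | ≺⇒∈ with x , x∈ , x-max ← maxBy ℓ x₀ xs =
    x , ∈⇒≺ x∈ , λ (z , x≺z , z≺y) → <⇒≱ (ℓ-≺ x≺z) (x-max (≺⇒∈ z≺y))

  ancestor : ∀ {i} y → i ≤ ℓ y → ∃[ x ] x ≼ y × ℓ x ≡ i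
  ancestor {i} y i≤ = go (ℓ y) y refl i≤
    where
    go : ∀ n y → ℓ y ≡ n → i ≤ n → ∃[ x ] x ≼ y × ℓ x ≡ i
    go n y ℓy i≤n with m≤n⇒m<n∨m≡n i≤n
    ... | inj₂ refl = y , ≼-refl , ℓy
    go (suc n) y ℓy i≤n | inj₁ (s≤s i≤n′)
      with p , p-y ← predecessor y ℓy
      with x , x≼p , ℓx ← go n p (suc-injective (trans (sym (ℓ-successor p-y)) ℓy)) i≤n′ =
      x , ≼-trans x≼p (proj₁ (proj₁ p-y)) , ℓx

  level : ℕ → List T
  level zero    = proj₁ finiteRoots
  level (suc n) = concatMap (λ x → proj₁ (finiteBranching x)) (level n)

  ∈-level : ∀ {n} x → ℓ x ≡ n → x ∈ level n
  ∈-level {zero}  x ℓx = Equivalence.from (proj₂ (proj₂ finiteRoots) x) ℓx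
  ∈-level {suc n} x ℓx with p , p-x ← predecessor x ℓx =
    ∈-concatMap⁺ (λ x → proj₁ (finiteBranching x))
      (lose (∈-level p (suc-injective (trans (sym (ℓ-successor p-x)) ℓx)))
            (Equivalence.from (proj₂ (proj₂ (finiteBranching p)) x) p-x))

  levelsBelow : ℕ → List T
  levelsBelow zero    = []
  levelsBelow (suc n) = level n ++ levelsBelow n

  ∈-levelsBelow : ∀ {n} x → ℓ x < n → x ∈ levelsBelow n
  ∈-levelsBelow {suc n} x (s≤s ℓx≤n) with m≤n⇒m<n∨m≡n ℓx≤n
  ... | inj₂ ℓx≡n = ∈-++⁺ˡ (∈-level x ℓx≡n)
  ... | inj₁ ℓx<n = ∈-++⁺ʳ (level n) (∈-levelsBelow x ℓx<n)

  level⇒ℓ : ∀ {n x} → x ∈ level n → ℓ x ≡ n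
  level⇒ℓ {zero}  {x} x∈ = Equivalence.to (proj₂ (proj₂ finiteRoots) x) x∈
  level⇒ℓ {suc n} {x} x∈
    with p , p∈ , x∈p ← find (∈-concatMap⁻ (λ x → proj₁ (finiteBranching x)) {xs = level n} x∈) =
    trans (ℓ-successor (Equivalence.to (proj₂ (proj₂ (finiteBranching p)) x) x∈p)) (cong suc (level⇒ℓ p∈))

  levelsBelow⇒ℓ : ∀ {n x} → x ∈ levelsBelow n → ℓ x < n
  levelsBelow⇒ℓ {suc n} x∈ with ∈-++⁻ (level n) x∈
  ... | inj₁ x∈n = s≤s (≤-reflexive (level⇒ℓ x∈n))
  ... | inj₂ x∈< = m<n⇒m<1+n (levelsBelow⇒ℓ x∈<)

  infix 4 _≈[_]_
  _≈[_]_ : (T → T) → ℕ → (T → T) → Set a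
  F ≈[ n ] G = ∀ x → ℓ x < n → F x ≡ G x

  ≈-sym : ∀ {n F G} → F ≈[ n ] G → G ≈[ n ] F
  ≈-sym F≈G x x< = sym (F≈G x x<)

  ≈-trans : ∀ {n F G H} → F ≈[ n ] G → G ≈[ n ] H → F ≈[ n ] H
  ≈-trans F≈G G≈H x x< = trans (F≈G x x<) (G≈H x x<)

  ≈-weaken : ∀ {n n′ F G} → n ≤ n′ → F ≈[ n′ ] G → F ≈[ n ] G
  ≈-weaken n≤ F≈G x x< = F≈G x (<-≤-trans x< n≤)

  ≈-suc : ∀ {n F G} → F ≈[ n ] G → (∀ x → ℓ x ≡ n → F x ≡ G x) → F ≈[ suc n ] G
  ≈-suc F≈G at x (s≤s x≤) with m≤n⇒m<n∨m≡n x≤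
  ... | inj₁ x< = F≈G x x<
  ... | inj₂ x≡ = at x x≡

  ≈-∘ˡ : ∀ {n F G} H → F ≈[ n ] G → H ∘ F ≈[ n ] H ∘ G
  ≈-∘ˡ H F≈G x x< = cong H (F≈G x x<)

  map-≈ : ∀ {n F G p̄} → F ≈[ n ] G → All (λ q → ℓ q < n) p̄ → map F p̄ ≡ map G p̄
  map-≈ F≈G p̄< = map-cong-local (All.map (F≈G _) p̄<)

  𝒮-levels : ∀ {x p̄ c y} → 𝒮⟨ x , p̄ , c ⟩≃ y → ℓ y ≡ suc (ℓ x)
  𝒮-levels eq = ℓ-successor (S1-successor eq)

  -- Has i p̄ c y: the branch to y leaves its node at level i along (p̄ , c).
  Has : ℕ → List T → Sig → T → Set (a ⊔ o)
  Has i p̄ c y = ∃[ x ] ∃[ z ] ℓ x ≡ i × 𝒮⟨ x , p̄ , c ⟩≃ z × z ≼ y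

  Has-≼ : ∀ {i p̄ c y y′} → Has i p̄ c y → y ≼ y′ → Has i p̄ c y′
  Has-≼ (x , z , ℓx , eq , z≼y) y≼y′ = x , z , ℓx , eq , ≼-trans z≼y y≼y′

  ∃Has : ∀ {i} y → i < ℓ y → ∃[ p̄ ] ∃[ c ] Has i p̄ c y
  ∃Has y i< with z , z≼y , ℓz ← ancestor y i<
            with x , x-z ← predecessor z ℓz
            with p̄ , c , eq ← S3 x-z =
    p̄ , c , x , z , suc-injective (trans (sym (ℓ-successor x-z)) ℓz) , eq , z≼y

  Has-levels : ∀ {i p̄ c y} → Has i p̄ c y → All (λ q → ℓ q < i) p̄
  Has-levels (x , z , refl , eq , _) = S1-levels eq

  𝒮-functional : ∀ {x p̄ c y z} → 𝒮⟨ x , p̄ , c ⟩≃ y → 𝒮⟨ x , p̄ , c ⟩≃ z → y ≡ z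
  𝒮-functional e e′ = just-injective (trans (sym e) e′)

-- Level functions of maps, tight extensions and shifts

module Ramsey {a o s m : Level} (𝕋 : SMTree a o s m) (em : ExcludedMiddle (a ⊔ o ⊔ s ⊔ m)) where

  open SMTree 𝕋 using (sTree; 𝓜; 𝓜-resp-≗; 𝓜-shapePreserving; M1-id; M1-∘; M1-limit; M2; M3; 𝓜^; 𝓜^-∘) public
  open Levels sTree {m} em public

  opaque
    -- (M3) is the source: a map that skips only level n + 1 attains level n.
    node : ∀ n → ∃[ x ] ℓ x ≡ n
    node n with F , _ , only , _ ← M3 n (suc n) ≤-refl
           with _ , x , _ , ℓFx ← Equivalence.from (only n) (<⇒≢ ≤-refl) = F x , ℓFx

  opaque
    -- F̃ made total by reading it at the chosen node; by `ℓ-lev` the choice does not matter for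
    -- members of `𝓜`.
    lev : (T → T) → ℕ → ℕ
    lev F n = ℓ (F (proj₁ (node n)))

    lev-node : ∀ F n → lev F n ≡ ℓ (F (proj₁ (node n)))
    lev-node F n = refl

  module _ {F} (F∈ : 𝓜 F) where
    open ShapePreserving (𝓜-shapePreserving F∈)

    ℓ-lev : ∀ x → ℓ (F x) ≡ lev F (ℓ x)
    ℓ-lev x = trans (levelPreserving (sym (proj₂ (node (ℓ x))))) (sym (lev-node F (ℓ x)))

    ℓ-lev′ : ∀ {n x} → ℓ x ≡ n → ℓ (F x) ≡ lev F n
    ℓ-lev′ refl = ℓ-lev _

    𝓜-𝒮 : ∀ {x p̄ c y} → 𝒮⟨ x , p̄ , c ⟩≃ y →
           ∃[ y′ ] 𝒮⟨ F x , map F p̄ , c ⟩≃ y′ × y′ ≼ F y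
    𝓜-𝒮 = preserves-𝒮

    𝓜-successor : ∀ {x y} → ImmediateSuccessor x y → F x ≼ F y
    𝓜-successor x-y with p̄ , c , eq ← S3 x-y with y′ , eq′ , y′≼ ← preserves-𝒮 eq =
      ≼-trans (proj₁ (proj₁ (S1-successor eq′))) y′≼

    𝓜-≼ : ∀ {x y} → x ≼ y → F x ≼ F y
    𝓜-≼ {x} {y} = go (ℓ y) y refl
      where
      go : ∀ n y → ℓ y ≡ n → x ≼ y → F x ≼ F y
      go n y ℓy x≼y with x ≟ᵀ y
      ... | yes refl = ≼-refl
      go zero    y ℓy x≼y | no x≢y = ⊥-elim (n≮0 (subst (ℓ x <_) ℓy (ℓ-≺ (x≼y , x≢y))))
      go (suc n) y ℓy x≼y | no x≢y with p , p-y ← predecessor y ℓy =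
        ≼-trans (go n p (suc-injective (trans (sym (ℓ-successor p-y)) ℓy)) (≺⇒≼-pred p-y (x≼y , x≢y)))
                (𝓜-successor p-y)

    lev-< : ∀ {i j} → i < j → lev F i < lev F j
    lev-< {i} {j} i<j with ℓy ← proj₂ (node j)
      with x , x≼y , ℓx ← ancestor (proj₁ (node j)) (subst (i ≤_) (sym ℓy) (<⇒≤ i<j)) =
      subst₂ _<_ (ℓ-lev′ ℓx) (ℓ-lev′ ℓy) (ℓ-≺ (𝓜-≼ x≼y , λ Fx≡ → <⇒≢ i<j (trans (sym ℓx) (trans (cong ℓ (injective Fx≡)) ℓy))))

    open StrictlyIncreasing (lev F) lev-< public
      renaming (f-≤ to lev-≤; f-injective to lev-injective; ≤f to ≤lev)

    lev-∘ : ∀ G n → lev (F ∘ G) n ≡ lev F (lev G n)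
    lev-∘ G n = trans (lev-node (F ∘ G) n) (trans (ℓ-lev (G (proj₁ (node n)))) (cong (lev F) (sym (lev-node G n))))

    ℓ<⇒ℓF< : ∀ {n x} → ℓ x < n → ℓ (F x) < lev F n
    ℓ<⇒ℓF< {x = x} ℓx< = subst (_< _) (sym (ℓ-lev x)) (lev-< ℓx<)

    Has-𝓜 : ∀ {i p̄ c y} → Has i p̄ c y → Has (lev F i) (map F p̄) c (F y)
    Has-𝓜 (x , z , ℓx , eq , z≼y) with z′ , eq′ , z′≼ ← 𝓜-𝒮 eq =
      F x , z′ , ℓ-lev′ ℓx , eq′ , ≼-trans z′≼ (𝓜-≼ z≼y)

  lev-id : ∀ n → lev id n ≡ n
  lev-id n = trans (lev-node id n) (proj₂ (node n))

  lev-≈ : ∀ {n i F G} → F ≈[ n ] G → i < n → lev F i ≡ lev G i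
  lev-≈ {i = i} {F} {G} F≈G i<n =
    trans (lev-node F i) (trans (cong ℓ (F≈G _ (subst (_< _) (sym (proj₂ (node i))) i<n))) (sym (lev-node G i)))

  ≈-∘ʳ-suc : ∀ {n k F G H} → 𝓜 H → lev H n ≤ k → F ≈[ suc k ] G → F ∘ H ≈[ suc n ] G ∘ H
  ≈-∘ʳ-suc H∈ H≤ F≈G x (s≤s x≤) = F≈G _ (s≤s (≤-trans (≤-reflexive (ℓ-lev H∈ x)) (≤-trans (lev-≤ H∈ x≤) H≤)))

  𝓜^-id : ∀ {n} → 𝓜^ n id
  𝓜^-id = M1-id , λ _ _ → refl

  𝓜^-weaken : ∀ {n n′ F} → n ≤ n′ → 𝓜^ n′ F → 𝓜^ n F
  𝓜^-weaken n≤ (F∈ , F≈) = F∈ , ≈-weaken {G = id} n≤ F≈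

  -- The least value that F̃(n) can take, given F̃ on smaller arguments.
  floor : (T → T) → ℕ → ℕ
  floor F zero    = zero
  floor F (suc n) = suc (lev F n)

  floor≤lev : ∀ {F} → 𝓜 F → ∀ n → floor F n ≤ lev F n
  floor≤lev F∈ zero    = z≤n
  floor≤lev F∈ (suc n) = lev-< F∈ ≤-refl

  floor-≈ : ∀ {n F G} → F ≈[ n ] G → floor F n ≡ floor G n
  floor-≈ {zero}  F≈G = refl
  floor-≈ {suc n} F≈G = cong suc (lev-≈ F≈G ≤-refl)

  ℓ<⇒ℓF<floor : ∀ {F} → 𝓜 F → ∀ {n x} → ℓ x < n → ℓ (F x) < floor F n
  ℓ<⇒ℓF<floor F∈ {suc n} {x} (s≤s x≤n) = s≤s (subst (_≤ _) (sym (ℓ-lev F∈ x)) (lev-≤ F∈ x≤n))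

  Tight : (T → T) → ℕ → Set
  Tight F n = lev F n ≡ floor F n

  tight-id : ∀ n → Tight id n
  tight-id zero    = lev-id 0
  tight-id (suc n) = trans (lev-id (suc n)) (cong suc (sym (lev-id n)))

  -- Above level 0, y = 𝒮(x, p̄, c). The node 𝒮(F x, F p̄, c) lies below `F y` and by tightness has
  -- its level, so it is `F y`. The same node lies below `G y`, since x and p̄ are at levels where
  -- the maps agree.
  tight-least : ∀ {n F G} → 𝓜 F → 𝓜 G → Tight F n → F ≈[ n ] G → ∀ {y} → ℓ y ≡ n → F y ≼ G y
  tight-least {zero} {F} {G} F∈ G∈ tight F≈G {y} ℓy = subst (_≼ G y) y≡Fy (roots G∈)
    where
    roots : ∀ {H} → 𝓜 H → y ≼ H y
    roots H∈ = ShapePreserving.preserves-roots (𝓜-shapePreserving H∈) ℓy ≼-refl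
    y≡Fy = ≼∧ℓ≡⇒≡ (roots F∈) (trans ℓy (sym (trans (ℓ-lev′ F∈ ℓy) tight)))
  tight-least {suc n} {F} {G} F∈ G∈ tight F≈G {y} ℓy
    with x , x-y ← predecessor y ℓy
    with p̄ , c , eq ← S3 x-y
    with y₁ , eq₁ , y₁≼ ← 𝓜-𝒮 F∈ eq
    with y₂ , eq₂ , y₂≼ ← 𝓜-𝒮 G∈ eq =
    subst (_≼ G y) (trans (sym y₁≡y₂) (≼∧ℓ≡⇒≡ y₁≼ ℓ≡)) y₂≼
    where
    ℓx : ℓ x ≡ n
    ℓx = suc-injective (trans (sym (ℓ-successor x-y)) ℓy)
    ℓ≡ : ℓ y₁ ≡ ℓ (F y)
    ℓ≡ = trans (𝒮-levels eq₁) (trans (cong suc (ℓ-lev′ F∈ ℓx)) (sym (trans (ℓ-lev′ F∈ ℓy) tight)))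
    x< : ∀ {i} → i ≤ ℓ x → i < suc n
    x< i≤ = s≤s (subst (_ ≤_) ℓx i≤)
    y₁≡y₂ : y₁ ≡ y₂
    y₁≡y₂ = 𝒮-functional eq₁
      (subst₂ (λ x p̄ → 𝒮⟨ x , p̄ , c ⟩≃ y₂) (sym (F≈G x (x< ≤-refl)))
              (sym (map-≈ F≈G (All.map (x< ∘ <⇒≤) (S1-levels eq)))) eq₂)

  tight-unique : ∀ {n F G} → 𝓜 F → 𝓜 G → Tight F n → F ≈[ n ] G → lev F n ≡ lev G n → F ≈[ suc n ] G
  tight-unique F∈ G∈ tight F≈G lev≡ = ≈-suc F≈G λ y ℓy →
    ≼∧ℓ≡⇒≡ (tight-least F∈ G∈ tight F≈G ℓy) (trans (ℓ-lev′ F∈ ℓy) (trans lev≡ (sym (ℓ-lev′ G∈ ℓy))))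

  𝓜^-≼ : ∀ {n F} → 𝓜^ n F → ∀ {x} → ℓ x ≤ n → x ≼ F x
  𝓜^-≼ {n} {F} (F∈ , F≈) {x} x≤n = tight-least M1-id F∈ (tight-id _)
    (≈-sym {F = F} (≈-weaken {F = F} x≤n F≈)) refl

  Shift : ℕ → ℕ → (T → T) → Set _
  Shift m m′ H = 𝓜^ m H × (∀ d → lev H (m + d) ≡ m′ + d)

  shift-lev : ∀ {m m′ H} → Shift m m′ H → lev H m ≡ m′
  shift-lev {m} {m′} {H} (_ , sh) = trans (cong (lev H) (sym (+-identityʳ m))) (trans (sh 0) (+-identityʳ m′))

  shift-lev-suc : ∀ {m m′ H} → Shift m m′ H → lev H (suc m) ≡ suc m′
  shift-lev-suc {m} {m′} {H} (_ , sh) = trans (cong (lev H) (+-comm 1 m)) (trans (sh 1) (+-comm m′ 1))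

  shift-suc : ∀ {m m′ H} → Shift m m′ H → ∀ d → lev H (suc m + d) ≡ suc m′ + d
  shift-suc {m} {m′} {H} (_ , sh) d = trans (cong (lev H) (sym (+-suc m d))) (trans (sh (suc d)) (+-suc m′ d))

  shift-≤ : ∀ {m m′ H} → Shift m m′ H → m ≤ m′
  shift-≤ H∈@((H∈𝓜 , _) , _) = subst (_ ≤_) (shift-lev H∈) (≤lev H∈𝓜 _)

  shift-id : ∀ {m} → Shift m m id
  shift-id = 𝓜^-id , λ d → lev-id _

  shift-∘ : ∀ {m m′ m″ G H} → Shift m′ m″ G → Shift m m′ H → Shift m m″ (G ∘ H)
  shift-∘ {G = G} {H} G∈ H∈@(H∈^ , H-sh) =
    𝓜^-∘ (𝓜^-weaken (shift-≤ H∈) (proj₁ G∈)) H∈^ ,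
    λ d → trans (lev-∘ (proj₁ (proj₁ G∈)) H _) (trans (cong (lev G) (H-sh d)) (proj₂ G∈ d))

  tight-shift : ∀ {m m′ H} → Shift m m′ H → ∀ d → Tight H (suc m + d)
  tight-shift {m} {m′} H∈ d = trans (shift-suc H∈ d) (cong suc (sym (proj₂ H∈ d)))

  -- Levels alone force `F` to fix everything below l: there `lev F` is the identity function, `id`
  -- is tight, and a tight map is determined on a level by its values below and the level reached.
  skipsOnly⇒shift : ∀ {l F} → 𝓜 F → SkipsOnly F l → Shift l (suc l) F
  skipsOnly⇒shift {l} {F} F∈ only = (F∈ , fixed) , above
    where
    skips : ∀ n → lev F n ≢ l
    skips n eq = Equivalence.to (only l) (n , proj₁ (node n) , proj₂ (node n) , trans (sym (lev-node F n)) eq) refl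
    attains : ∀ {j} → j ≢ l → ∃[ n ] lev F n ≡ j
    attains {j} j≢l with n , x , ℓx , ℓFx ← Equivalence.from (only j) j≢l = n , trans (sym (ℓ-lev′ F∈ ℓx)) ℓFx
    open StrictlyIncreasing.Skipping (lev F) (lev-< F∈) l skips attains
    fixed≤ : ∀ n → n ≤ l → F ≈[ n ] id
    fixed≤ zero    n≤ x ()
    fixed≤ (suc n) n≤ = ≈-sym {F = id} (tight-unique M1-id F∈ (tight-id n) (≈-sym {F = F} (fixed≤ n (<⇒≤ n≤)))
      (trans (lev-id n) (sym (below n n≤))))
    fixed = fixed≤ l ≤-refl

  skips-gap : ∀ {n l F} → 𝓜 F → lev F n ≡ suc l → floor F n ≤ l → Skips F l
  skips-gap {n} F∈ lev≡ floor≤ (n′ , x , ℓx , ℓFx) with <-≤-connex n′ n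
  ... | inj₁ n′<n = <⇒≢ (<-≤-trans (ℓ<⇒ℓF<floor F∈ (subst (_< n) (sym ℓx) n′<n)) floor≤) ℓFx
  ... | inj₂ n≤n′ = 1+n≰n (subst₂ _≤_ lev≡ (trans (sym (ℓ-lev′ F∈ ℓx)) ℓFx) (lev-≤ F∈ n≤n′))

  -- The gap between `floor F n` and `lev F n` means that level l is skipped, so (M2) applies. Its
  -- `F₂` fixes the levels below l, which contain the images of the levels below n; hence `F₁`
  -- equals `F` there.
  lower-one : ∀ {n F} → 𝓜 F → ∀ {l} → lev F n ≡ suc l → floor F n ≤ l →
    ∃[ F₁ ] ∃[ F₂ ] 𝓜 F₁ × Shift l (suc l) F₂ × F₁ ≈[ n ] F × lev F₁ n ≡ l × F ≈[ suc n ] F₂ ∘ F₁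
  lower-one {n} {F} F∈ {l} lev≡ floor≤
    with F₁ , F₂ , F₁∈ , F₂∈ , only , eq ← M2 n l F F∈ (_ , proj₂ (node n) , trans (sym (lev-node F n)) lev≡) (skips-gap F∈ lev≡ floor≤) =
    F₁ , F₂ , F₁∈ , skipsOnly⇒shift F₂∈ only
    , F₁≈F (skipsOnly⇒shift F₂∈ only) eq
    , lev-injective F₂∈ (trans (sym (lev-∘ F₂∈ F₁ n)) (trans (lev-≈ {F = F₂ ∘ F₁} {F} (λ { x (s≤s x≤) → eq x x≤ }) ≤-refl)
        (trans lev≡ (sym (shift-lev (skipsOnly⇒shift F₂∈ only))))))
    , λ { x (s≤s x≤) → sym (eq x x≤) }
    where
    F₁≈F : ∀ {F₁ F₂} → Shift l (suc l) F₂ → (∀ x → ℓ x ≤ n → F₂ (F₁ x) ≡ F x) → F₁ ≈[ n ] F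
    F₁≈F {F₁} {F₂} ((F₂∈ , F₂≈) , _) eq x x<n = trans (sym (F₂≈ (F₁ x) (begin-strict
      ℓ (F₁ x)            ≤⟨ ≤lev F₂∈ _ ⟩
      lev F₂ (ℓ (F₁ x))   ≡⟨ ℓ-lev F₂∈ (F₁ x) ⟨
      ℓ (F₂ (F₁ x))       ≡⟨ cong ℓ (eq x (<⇒≤ x<n)) ⟩
      ℓ (F x)             <⟨ ℓ<⇒ℓF<floor F∈ x<n ⟩
      floor F n           ≤⟨ floor≤ ⟩
      l                   ∎))) (eq x (<⇒≤ x<n))
      where open ≤-Reasoning

  opaque
    tighten : ∀ {G} → 𝓜 G → ∀ n → ∃[ F ] ∃[ H ] 𝓜 F × Tight F n × F ≈[ n ] G ×
              Shift (lev F n) (lev G n) H × G ≈[ suc n ] H ∘ F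
    tighten G∈ n with d , eq ← m≤n⇒∃[o]m+o≡n (floor≤lev G∈ n) = go d G∈ (trans (sym eq) (+-comm _ d))
      where
      go : ∀ d {G} → 𝓜 G → lev G n ≡ d + floor G n → ∃[ F ] ∃[ H ] 𝓜 F × Tight F n × F ≈[ n ] G ×
           Shift (lev F n) (lev G n) H × G ≈[ suc n ] H ∘ F
      go zero    G∈ lev≡ = _ , id , G∈ , lev≡ , (λ _ _ → refl) , shift-id , λ _ _ → refl
      go (suc d) {G} G∈ lev≡
        with F₁ , F₂ , F₁∈ , F₂-sh , F₁≈G , F₁-lev , G≈ ← lower-one G∈ lev≡ (m≤n+m (floor G n) d)
        with F , H , F∈ , tight , F≈F₁ , H-sh , F₁≈ ← go d F₁∈ (trans F₁-lev (cong (d +_) (sym (floor-≈ {n} {F₁} {G} F₁≈G)))) =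
        F , F₂ ∘ H , F∈ , tight , ≈-trans {F = F} F≈F₁ F₁≈G
        , subst (λ l → Shift (lev F n) l (F₂ ∘ H)) (sym lev≡)
            (shift-∘ F₂-sh (subst (λ l → Shift (lev F n) l H) F₁-lev H-sh))
        , ≈-trans {F = G} G≈ (≈-∘ˡ {F = F₁} F₂ F₁≈)

  opaque
    factor : ∀ {n F G} → 𝓜 F → 𝓜 G → Tight F n → F ≈[ n ] G →
             ∃[ H ] Shift (lev F n) (lev G n) H × G ≈[ suc n ] H ∘ F
    factor {n} {F} {G} F∈ G∈ tight F≈G with F′ , H , F′∈ , tight′ , F′≈G , H-sh , G≈ ← tighten G∈ n =
      H , subst (λ l → Shift l (lev G n) H) (sym lev≡) H-sh
      , ≈-trans {F = G} G≈ (≈-∘ˡ {F = F′} H (≈-sym {F = F} (tight-unique F∈ F′∈ tight F≈F′ lev≡)))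
      where
      F≈F′ : F ≈[ n ] F′
      F≈F′ = ≈-trans {F = F} F≈G (≈-sym {F = F′} F′≈G)
      lev≡ : lev F n ≡ lev F′ n
      lev≡ = trans tight (trans (floor-≈ {n} {F} {F′} F≈F′) (sym tight′))

  opaque
    -- This is `factor` for the tight map `id`. It replaces a map of which only the action up to
    -- level n matters by one that moves all higher levels by the same amount.
    𝓜^⇒shift : ∀ {n F} → 𝓜^ n F → ∃[ H ] Shift n (lev F n) H × F ≈[ suc n ] H
    𝓜^⇒shift {n} {F} (F∈ , F≈) with H , H-sh , F≈H ← factor M1-id F∈ (tight-id n) (≈-sym {F = F} F≈) =
      H , subst (λ l → Shift l (lev F n) H) (lev-id n) H-sh , F≈H

  copy : ∀ {i m} → i < m → T → T
  copy {i} {m} i<m = proj₁ (M3 i m i<m)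

  copy-shift : ∀ {i m} (i<m : i < m) → Shift m (suc m) (copy i<m)
  copy-shift {i} {m} i<m with _ , F∈ , only , _ ← M3 i m i<m = skipsOnly⇒shift F∈ only

  copy-𝒮 : ∀ {i m} (i<m : i < m) {p̄ c y} → Has i p̄ c y → ℓ y ≡ m → 𝒮⟨ y , p̄ , c ⟩≃ copy i<m y
  copy-𝒮 {i} {m} i<m (x , z , ℓx , eq , z≼y) ℓy = proj₂ (proj₂ (proj₂ (M3 i m i<m))) ℓx ℓy eq z≼y

  -- Let (p̄, c) be the letter of y at level i. `H` fixes p̄, whose entries lie below level i, and y
  -- ≼ `H y`, so `H y` has this letter at level i too. As `H` moves levels m and m + 1 equally, it
  -- takes the successor of y along (p̄, c) to that of `H y`.
  shift-copy : ∀ {i m m′ H} (i<m : i < m) (i<m′ : i < m′) → Shift m m′ H →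
               H ∘ copy i<m ≈[ suc m ] copy i<m′ ∘ H
  shift-copy {i} {m} {m′} {H} i<m i<m′ H-sh@((H∈ , H≈) , _) = ≈-suc {F = H ∘ copy i<m} {copy i<m′ ∘ H} below at
    where
    fixed : ∀ {k} (i<k : i < k) → copy i<k ≈[ k ] id
    fixed i<k = proj₂ (proj₁ (copy-shift i<k))
    below : H ∘ copy i<m ≈[ m ] copy i<m′ ∘ H
    below x x<m = trans (cong H (fixed i<m x x<m))
      (sym (trans (cong (copy i<m′) (H≈ x x<m)) (trans (fixed i<m′ x (<-≤-trans x<m (shift-≤ H-sh))) (sym (H≈ x x<m)))))
    at : ∀ y → ℓ y ≡ m → H (copy i<m y) ≡ copy i<m′ (H y)
    at y ℓy with p̄ , c , has ← ∃Has y (subst (i <_) (sym ℓy) i<m)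
            with y′ , eq , y′≼ ← 𝓜-𝒮 H∈ (copy-𝒮 i<m has ℓy) =
      trans (sym (≼∧ℓ≡⇒≡ y′≼ (trans (𝒮-levels eq) (trans (cong suc (ℓ-lev′ H∈ ℓy))
              (trans (sym (trans (shift-lev-suc H-sh) (cong suc (sym (shift-lev H-sh)))))
                     (sym (ℓ-lev′ H∈ (trans (𝒮-levels (copy-𝒮 i<m has ℓy)) (cong suc ℓy)))))))))
        (𝒮-functional (subst (λ q̄ → 𝒮⟨ H y , q̄ , c ⟩≃ y′) Hp̄≡p̄ eq)
          (copy-𝒮 i<m′ (Has-≼ has (𝓜^-≼ (proj₁ H-sh) (≤-reflexive ℓy))) (trans (ℓ-lev′ H∈ ℓy) (shift-lev H-sh))))
      where
      Hp̄≡p̄ : map H p̄ ≡ p̄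
      Hp̄≡p̄ = trans (map-≈ H≈ (All.map (λ q< → <-trans q< i<m) (Has-levels has))) (map-id p̄)

  -- Fusion

  module _ {N} (K : ℕ → T → T) (K∈ : ∀ i → 𝓜^ (N + i) (K i)) where

    segment : ℕ → ℕ → T → T
    segment j zero    = id
    segment j (suc i) = segment j i ∘ K (j + i)

    segment-𝓜^ : ∀ j i → 𝓜^ (N + j) (segment j i)
    segment-𝓜^ j zero    = 𝓜^-id
    segment-𝓜^ j (suc i) = 𝓜^-∘ (segment-𝓜^ j i)
      (𝓜^-weaken (+-monoʳ-≤ N (m≤m+n j i)) (K∈ (j + i)))

    segment-++ : ∀ j i x → segment 0 (j + i) x ≡ segment 0 j (segment j i x)
    segment-++ j zero    x rewrite +-identityʳ j = refl
    segment-++ j (suc i) x rewrite +-suc j i = segment-++ j i (K (j + i) x)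

    segment-stable : ∀ j i x → ℓ x ≤ i → segment j (suc i) x ≡ segment j (suc (suc i)) x
    segment-stable j i x x≤i = cong (segment j (suc i)) (sym (proj₂ (K∈ (j + suc i)) x
      (≤-trans (s≤s x≤i) (≤-trans (m≤n+m (suc i) j) (m≤n+m (j + suc i) N)))))

    tail : ∀ j → ∃[ G ] 𝓜^ (N + j) G × (∀ i x → ℓ x ≤ i → G x ≡ segment j (suc i) x)
    tail j with G , G∈ , G≡ ← M1-limit (λ i → segment j (suc i)) (λ i → proj₁ (segment-𝓜^ j (suc i))) (segment-stable j) =
      G , (G∈ , λ x x< → trans (G≡ _ x ≤-refl) (proj₂ (segment-𝓜^ j (suc (ℓ x))) x x<)) , G≡

    tail-split : ∀ j → proj₁ (tail 0) ≗ segment 0 j ∘ proj₁ (tail j)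
    tail-split j x = begin
      proj₁ (tail 0) x                       ≡⟨ proj₂ (proj₂ (tail 0)) (j + ℓ x) x (m≤n+m (ℓ x) j) ⟩
      segment 0 (suc (j + ℓ x)) x            ≡⟨ cong (λ i → segment 0 i x) (+-suc j (ℓ x)) ⟨
      segment 0 (j + suc (ℓ x)) x            ≡⟨ segment-++ j (suc (ℓ x)) x ⟩
      segment 0 j (segment j (suc (ℓ x)) x)  ≡⟨ cong (segment 0 j) (proj₂ (proj₂ (tail j)) (ℓ x) x ≤-refl) ⟨
      segment 0 j (proj₁ (tail j) x)         ∎
      where open ≡-Reasoning

  opaque
    -- The map is the infinite composite of the `K j`, supplied by (M1) because `K j` fixes the
    -- levels below N + j. The factors behind `K j` compose to a member of `𝓜^ (N + suc j)`, the `G`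
    -- over which density quantifies, so requirement j stays met.
    fusion : ∀ N {q} (R : ℕ → (T → T) → Set q) → (∀ {j F G} → F ≗ G → R j F → R j G) →
      (∀ j {F} → 𝓜^ N F → ∃[ K ] 𝓜^ (N + j) K × (∀ {G} → 𝓜^ (N + suc j) G → R j (F ∘ K ∘ G))) →
      ∃[ F ] 𝓜^ N F × (∀ j → R j F)
    fusion N R resp dense =
      proj₁ (tail K K∈ 0) , subst (λ n → 𝓜^ n (proj₁ (tail K K∈ 0))) (+-identityʳ N) (proj₁ (proj₂ (tail K K∈ 0)))
      , λ j → resp (λ x → trans (segment-build (suc j) (proj₁ (tail K K∈ (suc j)) x)) (sym (tail-split K K∈ (suc j) x)))
                   (proj₂ (proj₂ (dense j (proj₂ (build j)))) (proj₁ (proj₂ (tail K K∈ (suc j)))))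
      where
      build : ℕ → ∃[ F ] 𝓜^ N F
      K : ℕ → T → T
      K∈ : ∀ j → 𝓜^ (N + j) (K j)
      build zero    = id , 𝓜^-id
      build (suc j) = proj₁ (build j) ∘ K j , 𝓜^-∘ (proj₂ (build j)) (𝓜^-weaken (m≤m+n N j) (K∈ j))
      K j  = proj₁ (dense j (proj₂ (build j)))
      K∈ j = proj₁ (proj₂ (dense j (proj₂ (build j))))
      segment-build : ∀ j → proj₁ (build j) ≗ segment K K∈ 0 j
      segment-build zero    x = refl
      segment-build (suc j) x = segment-build j (K j x)

  dense-All : ∀ {N k q b} {A : Set b} (R : A → (T → T) → Set q) (xs : List A) → N ≤ k →
    (∀ {x} → x ∈ xs → ∀ {F} → 𝓜^ N F → ∃[ K ] 𝓜^ k K × (∀ {G} → 𝓜^ k G → R x (F ∘ K ∘ G))) →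
    ∀ {F} → 𝓜^ N F → ∃[ K ] 𝓜^ k K × (∀ {G} → 𝓜^ k G → ∀ {x} → x ∈ xs → R x (F ∘ K ∘ G))
  dense-All R []       N≤k dense F∈ = id , 𝓜^-id , λ _ ()
  dense-All R (x ∷ xs) N≤k dense F∈
    with K , K∈ , RK ← dense (here refl) F∈
    with K′ , K′∈ , RK′ ← dense-All R xs N≤k (dense ∘ there) (𝓜^-∘ F∈ (𝓜^-weaken N≤k K∈)) =
    K ∘ K′ , 𝓜^-∘ K∈ K′∈ , λ where
      G∈ (here refl) → RK (𝓜^-∘ K′∈ G∈)
      G∈ (there x∈)  → RK′ G∈ x∈

  module _ {q} (em′ : ExcludedMiddle (a ⊔ q)) where

    -- A tree of case distinctions on the values at the points of `xs`; at a leaf all these values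
    -- are prescribed, and excluded middle either picks a member or reports that there is none.
    representatives : (P : (T → T) → Set (a ⊔ q)) (xs ys : List T) → (∀ {F} → P F → ∀ {x} → x ∈ xs → F x ∈ ys) →
      Σ[ Fs ∈ List (T → T) ] (∀ {F} → F ∈ Fs → P F) ×
        (∀ {F} → P F → ∃[ G ] G ∈ Fs × (∀ x → x ∈ xs → F x ≡ G x))
    representatives P []       ys confined with em′ {∃[ F ] P F}
    ... | yes (F , PF) = F ∷ [] , (λ { (here refl) → PF }) , λ _ → F , here refl , λ _ ()
    ... | no none      = [] , (λ ()) , λ PF → ⊥-elim (none (_ , PF))
    representatives P (x ∷ xs) ys confined = let Fs , Fs-P , Fs-rep = splitAt ys in
      Fs , Fs-P , λ PF → Fs-rep PF (confined PF (here refl))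
      where
      splitAt : ∀ zs → Σ[ Fs ∈ List (T → T) ] (∀ {F} → F ∈ Fs → P F) ×
                  (∀ {F} → P F → F x ∈ zs → ∃[ G ] G ∈ Fs × (∀ y → y ∈ x ∷ xs → F y ≡ G y))
      splitAt []       = [] , (λ ()) , λ _ ()
      splitAt (z ∷ zs)
        with Fs , Fs-P , Fs-rep ← representatives (λ F → P F × F x ≡ z) xs ys (λ (PF , _) → confined PF ∘ there)
        with Gs , Gs-P , Gs-rep ← splitAt zs =
        Fs ++ Gs
        , (λ F∈ → case ∈-++⁻ Fs F∈ of λ where
             (inj₁ F∈Fs) → proj₁ (Fs-P F∈Fs)
             (inj₂ F∈Gs) → Gs-P F∈Gs)
        , λ where
            PF (here Fx≡z) → case Fs-rep (PF , Fx≡z) of λ (G , G∈ , F≡G) →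
              G , ∈-++⁺ˡ G∈ , λ where
                _ (here refl) → trans Fx≡z (sym (proj₂ (Fs-P G∈)))
                y (there y∈)  → F≡G y y∈
            PF (there Fx∈) → case Gs-rep PF Fx∈ of λ (G , G∈ , F≡G) → G , ∈-++⁺ʳ Fs G∈ , F≡G

    levelRepresentatives : ∀ n k (P : (T → T) → Set (a ⊔ q)) → (∀ {F} → P F → 𝓜 F × lev F n ≤ k) →
      Σ[ Fs ∈ List (T → T) ] (∀ {F} → F ∈ Fs → P F) ×
        (∀ {F} → P F → ∃[ G ] G ∈ Fs × F ≈[ suc n ] G)
    levelRepresentatives n k P bound
      with Fs , Fs-P , Fs-rep ← representatives P (levelsBelow (suc n)) (levelsBelow (suc k))
             (λ PF x∈ → ∈-levelsBelow _ (s≤s (≤-trans (≤-reflexive (ℓ-lev (proj₁ (bound PF)) _))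
               (≤-trans (lev-≤ (proj₁ (bound PF)) (s≤s⁻¹ (levelsBelow⇒ℓ x∈))) (proj₂ (bound PF)))))) =
      Fs , Fs-P , λ PF → case Fs-rep PF of λ (G , G∈ , F≡G) → G , G∈ , λ x x< → F≡G x (∈-levelsBelow x x<)

  -- Rich maps

  dec : ∀ {q} → ExcludedMiddle (q ⊔ (a ⊔ o ⊔ s ⊔ m)) → (P : Set q) → Dec P
  dec = decide {L = a ⊔ o ⊔ s ⊔ m}

  level-successor : ∀ {x y} → x ≼ y → ℓ y ≡ suc (ℓ x) → ImmediateSuccessor x y
  level-successor {x} {y} x≼y ℓy = (x≼y , λ { refl → 1+n≢n (sym ℓy) }) , λ (z , x≺z , z≺y) →
    1+n≰n (≤-trans (s≤s (ℓ-≺ x≺z)) (subst (ℓ z <_) ℓy (ℓ-≺ z≺y)))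

  OneStep : ℕ → (T → T) → Set _
  OneStep n y = 𝓜^ n y × lev y n ≡ suc n

  -- Below F(x), at some common level i, the branch already follows the F-image
  -- of the letter that y adds to x; so F ∘ y can be imitated by a copy of level i.
  RichFor : (T → T) → (T → T) → ℕ → Set _
  RichFor y F n = ∃[ i ] i < lev F n ×
    (∀ {x p̄ c} → ℓ x ≡ n → 𝒮⟨ x , p̄ , c ⟩≃ y x → Has i (map F p̄) c (F x))

  Rich : (T → T) → ℕ → Set _
  Rich F n = ∀ {y} → OneStep n y → RichFor y F n

  richFor-∘ˡ : ∀ {y F n U} → 𝓜 U → RichFor y F n → RichFor y (U ∘ F) n
  richFor-∘ˡ {y} {F} {n} {U} U∈ (i , i< , has) =
    lev U i , subst (lev U i <_) (sym (lev-∘ U∈ F n)) (lev-< U∈ i<) , λ ℓx eq →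
      subst (λ q̄ → Has _ q̄ _ _) (sym (map-∘ _)) (Has-𝓜 U∈ (has ℓx eq))

  richFor-∘ʳ : ∀ {y F n V} → 𝓜 F → 𝓜^ n V → RichFor y F n → RichFor y (F ∘ V) n
  richFor-∘ʳ {y} {F} {n} {V} F∈ V∈@(V∈𝓜 , V≈) (i , i< , has) =
    i , <-≤-trans i< (subst (lev F n ≤_) (sym (lev-∘ F∈ V n)) (lev-≤ F∈ (≤lev V∈𝓜 n))) , λ {x} ℓx eq →
      Has-≼ (subst (λ q̄ → Has i q̄ _ (F x))
               (map-≈ {F = F} {F ∘ V} (λ z z< → cong F (sym (V≈ z z<))) (subst (λ n → All (λ q → ℓ q < n) _) ℓx (S1-levels eq)))
               (has ℓx eq))
            (𝓜-≼ F∈ (𝓜^-≼ V∈ (≤-reflexive ℓx)))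

  richFor-≈ : ∀ {y F G n} → F ≈[ suc n ] G → RichFor y F n → RichFor y G n
  richFor-≈ {F = F} {G} F≈G (i , i< , has) = i , subst (i <_) (lev-≈ F≈G ≤-refl) i< , λ {x} ℓx eq →
    subst₂ (λ q̄ z → Has i q̄ _ z)
      (map-≈ F≈G (All.map m<n⇒m<1+n (subst (λ n → All (λ q → ℓ q < n) _) ℓx (S1-levels eq))))
      (F≈G x (s≤s (≤-reflexive ℓx))) (has ℓx eq)

  rich-∘ˡ : ∀ {F n U} → 𝓜 U → Rich F n → Rich (U ∘ F) n
  rich-∘ˡ U∈ rich y-step = richFor-∘ˡ U∈ (rich y-step)

  rich-≈ : ∀ {F G n} → F ≈[ suc n ] G → Rich F n → Rich G n
  rich-≈ F≈G rich y-step = richFor-≈ F≈G (rich y-step)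

  richFor-self : ∀ {y n} → OneStep n y → RichFor y y n
  richFor-self {y} {n} ((y∈ , y≈) , y-lev) = n , ≤-reflexive (sym y-lev) , λ {x} ℓx eq →
    x , y x , ℓx
    , subst (λ q̄ → 𝒮⟨ x , q̄ , _ ⟩≃ y x)
        (sym (trans (map-≈ y≈ (subst (λ n → All (λ q → ℓ q < n) _) ℓx (S1-levels eq))) (map-id _))) eq
    , ≼-refl

  richForAll : ∀ {n} ys → (∀ {y} → y ∈ ys → OneStep n y) → ∃[ E ] 𝓜^ n E × (∀ {y} → y ∈ ys → RichFor y E n)
  richForAll []       _     = id , 𝓜^-id , λ ()
  richForAll (y ∷ ys) steps with E , E∈ , rich ← richForAll ys (steps ∘ there) =
    y ∘ E , 𝓜^-∘ (proj₁ (steps (here refl))) E∈ , λ where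
      (here refl) → richFor-∘ʳ (proj₁ (proj₁ (steps (here refl)))) E∈ (richFor-self (steps (here refl)))
      (there y∈)  → richFor-∘ˡ (proj₁ (proj₁ (steps (here refl)))) (rich y∈)

  opaque
    -- A one-step y satisfies `RichFor y y n`, and this survives composition on both sides, so the
    -- composite of representatives of all one-step maps is rich. Passing to a shift then controls
    -- its higher levels.
    ∃rich : ∀ n → ∃[ n′ ] ∃[ E ] Shift n n′ E × Rich E n
    ∃rich n
      with ys , steps , rep ← levelRepresentatives {q = m} (λ {P} → dec em P) n (suc n) (OneStep n) (λ ((y∈ , _) , y-lev) → y∈ , ≤-reflexive y-lev)
      with E , E∈ , rich ← richForAll ys steps
      with H , H-sh , E≈H ← 𝓜^⇒shift E∈ =
      lev E n , H , H-sh , λ {y} y-step → richFor-≈ {y} E≈H (let y′ , y′∈ , y≈y′ = rep y-step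
                                                                 i , i< , has = rich y′∈ in
        i , i< , λ {x} ℓx eq → has ℓx (trans eq (cong just (y≈y′ x (s≤s (≤-reflexive ℓx))))))

  -- `P` carries one-step maps to one-step maps: tightness at n factors `P ∘ y` as `W ∘ P` up to
  -- level n, and tightness at n + 1 makes `W` a single step. `P` takes the letter added by y to the
  -- one added by `W`, for which `Z` is rich.
  rich-∘ : ∀ {Z P n} → 𝓜 Z → 𝓜 P → Tight P n → Tight P (suc n) → Rich Z (lev P n) → Rich (Z ∘ P) n
  rich-∘ {Z} {P} {n} Z∈ P∈ tight tight′ rich {y} ((y∈ , y≈) , y-lev)
    with W , W-sh , Py≈ ← factor P∈ (M1-∘ P∈ y∈) tight (λ x x< → cong P (sym (y≈ x x<)))
    = let i , i< , has = rich (proj₁ W-sh , trans (shift-lev W-sh) lev≡) in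
      i , subst (i <_) (sym (lev-∘ Z∈ P n)) i< , λ {x} {p̄} {c} ℓx eq →
      let d , d-eq , d≼ = 𝓜-𝒮 P∈ eq
          Pyx≡ : P (y x) ≡ W (P x)
          Pyx≡ = Py≈ x (s≤s (≤-reflexive ℓx))
          d≡ : d ≡ P (y x)
          d≡ = ≼∧ℓ≡⇒≡ d≼ (trans (𝒮-levels d-eq) (trans (cong suc (ℓ-lev′ P∈ ℓx))
                 (trans (sym tight′) (sym (ℓ-lev′ P∈ (trans (ℓ-lev′ y∈ ℓx) y-lev))))))
      in subst (λ q̄ → Has i q̄ c (Z (P x))) (sym (map-∘ p̄))
           (has (ℓ-lev′ P∈ ℓx) (trans d-eq (cong just (trans d≡ Pyx≡))))
    where
    lev≡ : lev (P ∘ y) n ≡ suc (lev P n)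
    lev≡ = trans (lev-∘ P∈ y n) (trans (cong (lev P) y-lev) tight′)

  -- By tightness `f (y x)` is the successor of `f x` along the image of the letter that y adds;
  -- richness finds that very letter at level i of `f x`, from where `copy` repeats it.
  rich-copy : ∀ {f n y} → 𝓜 f → Rich f n → Tight f (suc n) → OneStep n y →
              ∃[ i ] Σ[ i< ∈ i < lev f n ] f ∘ y ≈[ suc n ] copy i< ∘ f
  rich-copy {f} {n} {y} f∈ rich tight y-step@(y∈@(y∈𝓜 , y≈) , y-lev) with i , i< , has ← rich y-step =
    i , i< , ≈-suc {F = f ∘ y} {copy i< ∘ f}
      (λ x x< → trans (cong f (y≈ x x<)) (sym (proj₂ (proj₁ (copy-shift i<)) (f x) (ℓ<⇒ℓF< f∈ x<))))
      at
    where
    at : ∀ x → ℓ x ≡ n → f (y x) ≡ copy i< (f x)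
    at x ℓx
      with p̄ , c , eq ← S3 (level-successor (𝓜^-≼ y∈ (≤-reflexive ℓx)) (trans (ℓ-lev′ y∈𝓜 ℓx) (trans y-lev (cong suc (sym ℓx)))))
      with d , d-eq , d≼ ← 𝓜-𝒮 f∈ eq =
      trans (sym (≼∧ℓ≡⇒≡ d≼ (trans (𝒮-levels d-eq) (trans (cong suc (ℓ-lev′ f∈ ℓx))
              (trans (sym tight) (sym (ℓ-lev′ f∈ (trans (ℓ-lev′ y∈𝓜 ℓx) y-lev))))))))
            (𝒮-functional d-eq (copy-𝒮 i< (has ℓx eq) (ℓ-lev′ f∈ ℓx)))

  -- Large sets

  byContradiction : (P : Set (a ⊔ m)) → ¬ ¬ P → P
  byContradiction P = decidable-stable (dec em P)

  Property : Set _
  Property = (T → T) → Set (a ⊔ m)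

  Large : ℕ → Property → Set _
  Large n Q = ∀ {K} → 𝓜^ n K → ∃[ h ] 𝓜^ n h × Q (K ∘ h)

  Avoidable : ℕ → Property → Set _
  Avoidable n Q = ∃[ K ] 𝓜^ n K × (∀ {h} → 𝓜^ n h → ¬ Q (K ∘ h))

  -- Largeness made uniform: the height n + j no longer depends on `K`, so up to level n only
  -- finitely many e matter. The price is the fixed `k` in front.
  Syndetic : ℕ → Property → Set _
  Syndetic n Q = ∃[ k ] 𝓜^ n k × ∃[ j ] (∀ {K} → 𝓜^ (n + j) K → ∃[ e ] 𝓜^ n e × lev e n ≡ n + j × Q (k ∘ K ∘ e))

  Local : ℕ → Property → Set _
  Local n Q = ∀ {F G} → 𝓜 F → 𝓜 G → F ≈[ suc n ] G → Q F → Q G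

  ¬large : ∀ {n Q} → ¬ Large n Q → Avoidable n Q
  ¬large {n} {Q} ¬lg = byContradiction (Avoidable n Q) λ none →
    ¬lg λ {K} K∈ → byContradiction (∃[ h ] 𝓜^ n h × Q (K ∘ h)) λ no-h → none (K , K∈ , λ h∈ Qh → no-h (_ , h∈ , Qh))

  -- Otherwise fusion would produce a member of 𝓜^ n that avoids Q entirely.
  syndetic : ∀ {n Q} → Local n Q → Large n Q → Syndetic n Q
  syndetic {n} {Q} local large = byContradiction (Syndetic n Q) λ none →
    let F , F∈ , avoids = fusion n Avoids (λ {j} → resp {j}) (dense none)
        e , e∈ , Qe = large F∈
        j , n+j≡ = m≤n⇒∃[o]m+o≡n (≤lev (proj₁ e∈) n)
    in avoids j (proj₁ F∈) e∈ (sym n+j≡) Qe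
    where
    Avoids : ℕ → (T → T) → Set _
    Avoids j F = 𝓜 F → ∀ {e} → 𝓜^ n e → lev e n ≡ n + j → ¬ Q (F ∘ e)
    resp : ∀ {j F G} → F ≗ G → Avoids j F → Avoids j G
    resp F≗G av G∈ e∈ e-lev QG = av F∈ e∈ e-lev
      (local (M1-∘ G∈ (proj₁ e∈)) (M1-∘ F∈ (proj₁ e∈)) (λ x _ → sym (F≗G _)) QG)
      where F∈ = 𝓜-resp-≗ (λ x → sym (F≗G x)) G∈
    Dense : ℕ → (T → T) → Set _
    Dense j F = ∃[ K ] 𝓜^ (n + j) K × (∀ {G} → 𝓜^ (n + suc j) G → Avoids j (F ∘ K ∘ G))
    dense : ¬ Syndetic n Q → ∀ j {F} → 𝓜^ n F → Dense j F
    dense none j {F} F∈ = byContradiction (Dense j F) λ no-K → none (F , F∈ , j , λ {K} K∈ →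
      byContradiction (∃[ e ] 𝓜^ n e × lev e n ≡ n + j × Q (F ∘ K ∘ e)) λ no-e → no-K (K , K∈ , λ {G} G∈ FKG∈ {e} e∈ e-lev QFKGe →
        let FK∈ = M1-∘ (proj₁ F∈) (proj₁ K∈) in
        no-e (e , e∈ , e-lev , local (M1-∘ FKG∈ (proj₁ e∈)) (M1-∘ FK∈ (proj₁ e∈))
          -- On the levels that `Q` sees, `e` stays at or below level n + j, which `G` fixes; so `G`
          -- drops out.
          (λ { x (s≤s x≤) → cong (F ∘ K) (proj₂ G∈ (e x) (begin-strict
             ℓ (e x)     ≡⟨ ℓ-lev (proj₁ e∈) x ⟩
             lev e (ℓ x) ≤⟨ lev-≤ (proj₁ e∈) x≤ ⟩
             lev e n     ≡⟨ e-lev ⟩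
             n + j       <⟨ n<1+n _ ⟩
             suc (n + j) ≡⟨ +-suc n j ⟨
             n + suc j   ∎)) }) QFKGe)))
      where open ≤-Reasoning

  -- A step that can be continued: `Q (k ∘ G)` settles the present level, the large set keeps the
  -- next one possible for all copies simultaneously, and richness of `G` prepares the step after
  -- that. The threshold is `lev G (suc n)` because `copy` moves level n to n + 1.
  Splits : ℕ → Property → (T → T) → (T → T) → Set _
  Splits n Q k G = 𝓜^ n k × 𝓜^ n G × Rich G (suc n) × Q (k ∘ G) ×
    Large (lev G (suc n)) (λ h → ∀ {i} (i<n : i < n) → Q (k ∘ h ∘ G ∘ copy i<n))

  -- Fusion shrinks a counterexample to the one-step lemma until it has no
  -- configuration at all.
  NoConfiguration : ℕ → Property → Set _
  NoConfiguration n Q = ∀ {G} → 𝓜^ n G → Rich G (suc n) → Q G → ¬ (∀ {i} (i<n : i < n) → Q (G ∘ copy i<n))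

  copy-≈ : ∀ {n F G i} (i<n : i < n) → F ≈[ suc (suc n) ] G → F ∘ copy i<n ≈[ suc n ] G ∘ copy i<n
  copy-≈ {n} {F} {G} i<n = ≈-∘ʳ-suc {F = F} {G} (proj₁ (proj₁ (copy-shift i<n))) (≤-reflexive (shift-lev (copy-shift i<n)))

  -- Given `F` and a rich `G` with `Q (F ∘ G)`, the absence of splits makes the set of copies not
  -- large, so some `K` avoids it. For each value of `lev G (suc n)` only finitely many `G` differ
  -- up to level n + 1; fusion runs over these values.
  noConfiguration : ∀ {n Q} → Local n Q → (∀ {k G} → ¬ Splits n Q k G) →
    ∃[ F ] 𝓜^ n F × NoConfiguration n (λ h → Q (F ∘ h))
  noConfiguration {n} {Q} local none =
    let F , F∈ , avoids = fusion n Avoids (λ {j} → resp {j}) dense in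
    F , F∈ , λ {G} G∈ rich QFG → let j , eq = m≤n⇒∃[o]m+o≡n (≤-trans (n≤1+n n) (≤lev (proj₁ G∈) (suc n))) in
      avoids j (proj₁ F∈) (G∈ , rich , sym eq) QFG
    where
    At : ℕ → (T → T) → Set _
    At j G = 𝓜^ n G × Rich G (suc n) × lev G (suc n) ≡ n + j
    Avoids₁ : (T → T) → (T → T) → Set _
    Avoids₁ G F = Q (F ∘ G) → ¬ (∀ {i} (i<n : i < n) → Q (F ∘ G ∘ copy i<n))
    Avoids : ℕ → (T → T) → Set _
    Avoids j F = 𝓜 F → ∀ {G} → At j G → Avoids₁ G F
    resp : ∀ {j F F′} → F ≗ F′ → Avoids j F → Avoids j F′
    resp F≗F′ av F′∈ {G} at@(G∈ , _) QF′G QF′Gc = av F∈ at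
      (local (M1-∘ F′∈ (proj₁ G∈)) (M1-∘ F∈ (proj₁ G∈)) (λ x _ → sym (F≗F′ _)) QF′G)
      (λ i<n → local (M1-∘ F′∈ (Gc∈ i<n)) (M1-∘ F∈ (Gc∈ i<n)) (λ x _ → sym (F≗F′ _)) (QF′Gc i<n))
      where
      F∈ = 𝓜-resp-≗ (λ x → sym (F≗F′ x)) F′∈
      Gc∈ : ∀ {i} (i<n : i < n) → 𝓜 (G ∘ copy i<n)
      Gc∈ i<n = M1-∘ (proj₁ G∈) (proj₁ (proj₁ (copy-shift i<n)))
    dense₁ : ∀ {j G} → At j G → ∀ {F} → 𝓜^ n F →
      ∃[ K ] 𝓜^ (n + j) K × (∀ {H} → 𝓜^ (n + j) H → Avoids₁ G (F ∘ K ∘ H))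
    dense₁ {j} {G} (G∈ , rich , G-lev) {F} F∈ with dec em (Q (F ∘ G))
    -- `H` fixes the images under `G` of the levels up to n, so the failure of `Q` persists.
    ... | no ¬QFG = id , 𝓜^-id , λ {H} H∈ QFHG → ⊥-elim (¬QFG
      (local (M1-∘ (proj₁ F∈) (M1-∘ (proj₁ H∈) (proj₁ G∈))) (M1-∘ (proj₁ F∈) (proj₁ G∈))
        (λ x x<n → cong F (proj₂ H∈ (G x) (subst (ℓ (G x) <_) G-lev (ℓ<⇒ℓF< (proj₁ G∈) x<n)))) QFHG))
    ... | yes QFG =
      let K , K∈ , avoids = ¬large {Q = λ h → ∀ {i} (i<n : i < n) → Q (F ∘ h ∘ G ∘ copy i<n)} (λ lg → none {F} {G} (F∈ , G∈ , rich , QFG , lg))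
      in K , 𝓜^-weaken (≤-reflexive (sym G-lev)) K∈ , λ H∈ _ → avoids (𝓜^-weaken (≤-reflexive G-lev) H∈)
    dense : ∀ j {F} → 𝓜^ n F → ∃[ K ] 𝓜^ (n + j) K × (∀ {H} → 𝓜^ (n + suc j) H → Avoids j (F ∘ K ∘ H))
    dense j {F} F∈
      with Gs , at , rep ← levelRepresentatives {q = o ⊔ s ⊔ m} em (suc n) (n + j) (At j) (λ ((G∈ , _) , _ , G-lev) → G∈ , ≤-reflexive G-lev)
      with K , K∈ , avoids ← dense-All Avoids₁ Gs (m≤m+n n j) (dense₁ {j} ∘ at) F∈ =
      K , K∈ , λ {H} H∈ F′∈ {G} G-at@(G∈ , _) QG QGc →
        let G′ , G′∈Gs , G≈G′ = rep G-at
            G′∈ = proj₁ (at G′∈Gs)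
            F′ = F ∘ K ∘ H
        in avoids (𝓜^-weaken (+-monoʳ-≤ n (n≤1+n j)) H∈) G′∈Gs
             (local (M1-∘ F′∈ (proj₁ G∈)) (M1-∘ F′∈ (proj₁ G′∈)) (≈-∘ˡ {F = G} {G′} F′ (≈-weaken {F = G} (n≤1+n _) G≈G′)) QG)
             (λ i<n → local (M1-∘ F′∈ (M1-∘ (proj₁ G∈) (proj₁ (proj₁ (copy-shift i<n)))))
                            (M1-∘ F′∈ (M1-∘ (proj₁ G′∈) (proj₁ (proj₁ (copy-shift i<n)))))
                            (≈-∘ˡ {F = G ∘ copy i<n} F′ (copy-≈ {F = G} i<n G≈G′)) (QGc i<n))

  -- A word over Fin M acts by appending its letters to every branch, as copies
  -- of the letters at levels below M; after each letter enough levels are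
  -- inserted to make the next level rich.
  module WordMaps (M : ℕ) where

    open Words (allFin M) ∈-allFin public

    stage : ℕ → ℕ
    stage zero    = M
    stage (suc j) = proj₁ (∃rich (suc (stage j)))

    Z : ℕ → T → T
    Z j = proj₁ (proj₂ (∃rich (suc (stage j))))

    Z-shift : ∀ j → Shift (suc (stage j)) (stage (suc j)) (Z j)
    Z-shift j = proj₁ (proj₂ (proj₂ (∃rich (suc (stage j)))))

    Z-rich : ∀ j → Rich (Z j) (suc (stage j))
    Z-rich j = proj₂ (proj₂ (proj₂ (∃rich (suc (stage j)))))

    stage-< : ∀ j → stage j < stage (suc j)
    stage-< j = shift-≤ (Z-shift j)

    letter< : ∀ j (x : Fin M) → toℕ x < stage j
    letter< zero    x = toℕ<n x
    letter< (suc j) x = <-trans (letter< j x) (stage-< j)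

    M≤stage : ∀ j → M ≤ stage j
    M≤stage zero    = ≤-refl
    M≤stage (suc j) = ≤-trans (M≤stage j) (<⇒≤ (stage-< j))

    add : ∀ j {i} → i < stage j → T → T
    add j i< = Z j ∘ copy i<

    add-shift : ∀ j {i} (i< : i < stage j) → Shift (stage j) (stage (suc j)) (add j i<)
    add-shift j i< = shift-∘ (Z-shift j) (copy-shift i<)

    after : ∀ {b} {B : Set b} → ℕ → List B → ℕ
    after j []      = j
    after j (_ ∷ w) = after (suc j) w

    run : ℕ → List (Fin M) → T → T
    run j []      = id
    run j (x ∷ w) = run (suc j) w ∘ add j (letter< j x)

    run-shift : ∀ j w → Shift (stage j) (stage (after j w)) (run j w)
    run-shift j []      = shift-id
    run-shift j (x ∷ w) = shift-∘ (run-shift (suc j) w) (add-shift j (letter< j x))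

    run-++ : ∀ j u w → run j (u ++ w) ≡ run (after j u) w ∘ run j u
    run-++ j []      w = refl
    run-++ j (x ∷ u) w = cong (_∘ add j (letter< j x)) (run-++ (suc j) u w)

    -- The variable copies whatever letter the branch has at level v, possibly different letters on
    -- different branches.
    runVar : ∀ j {v} → v < stage j → List (Maybe (Fin M)) → T → T
    runVar j v< []             = id
    runVar j v< (just x ∷ w)  = runVar (suc j) (<-trans v< (stage-< j)) w ∘ add j (letter< j x)
    runVar j v< (nothing ∷ w) = runVar (suc j) (<-trans v< (stage-< j)) w ∘ add j v<

    runVar-𝓜^ : ∀ j {v} (v< : v < stage j) w → 𝓜^ (stage j) (runVar j v< w)
    runVar-𝓜^ j v< []             = 𝓜^-id
    runVar-𝓜^ j v< (just x ∷ w)  = 𝓜^-∘ (𝓜^-weaken (<⇒≤ (stage-< j)) (runVar-𝓜^ (suc j) _ w)) (proj₁ (add-shift j _))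
    runVar-𝓜^ j v< (nothing ∷ w) = 𝓜^-∘ (𝓜^-weaken (<⇒≤ (stage-< j)) (runVar-𝓜^ (suc j) _ w)) (proj₁ (add-shift j _))

    SameLetter : ℕ → ℕ → T → Set _
    SameLetter i j y = ∃[ p̄ ] ∃[ c ] Has i p̄ c y × Has j p̄ c y

    -- The branch only grows, so its letters at the two levels stay equal, and copying either level
    -- gives the same successor.
    runVar-≡ : ∀ j {v} (v< : v < stage j) w {x y} → ℓ y ≡ stage j → SameLetter v (toℕ x) y →
               runVar j v< w y ≡ run j (w [ x ]) y
    runVar-≡ j v< []             ℓy same = refl
    runVar-≡ j v< (l ∷ w) {x} {y} ℓy (p̄ , c , has-v , has-x) = step l
      where
      next : ∀ {i} (i< : i < stage j) → runVar (suc j) (<-trans v< (stage-< j)) w (add j i< y) ≡ run (suc j) (w [ x ]) (add j i< y)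
      next i< = runVar-≡ (suc j) _ w
        (trans (ℓ-lev′ (proj₁ (proj₁ (add-shift j i<))) ℓy) (shift-lev (add-shift j i<)))
        (p̄ , c , Has-≼ has-v y≼ , Has-≼ has-x y≼)
        where y≼ = 𝓜^-≼ (proj₁ (add-shift j i<)) (≤-reflexive ℓy)
      step : ∀ l → runVar j v< (l ∷ w) y ≡ run j ((l ∷ w) [ x ]) y
      step (just x′) = next (letter< j x′)
      step nothing   = trans (next v<) (cong (run (suc j) (w [ x ]) ∘ Z j)
        (𝒮-functional (copy-𝒮 v< has-v ℓy) (copy-𝒮 (letter< j x) has-x ℓy)))

    -- The action of the line (u ∙ t) on the levels from n on, where H moves
    -- level n to level M; its variable repeats the letter at level n.
    module LineMap {n H} (H-shift : Shift n M H) (u : List (Fin M)) (t : List (Maybe (Fin M))) where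

      J : ℕ
      J = after 0 u

      P V lineMap : T → T
      P = run 0 u ∘ H
      V = runVar (suc J) (stage-< J) t
      lineMap = V ∘ Z J ∘ P

      n≤stage : ∀ i → n ≤ stage i
      n≤stage i = ≤-trans (shift-≤ H-shift) (M≤stage i)

      P-shift : Shift n (stage J) P
      P-shift = shift-∘ (run-shift 0 u) H-shift

      P∈ : 𝓜 P
      P∈ = proj₁ (proj₁ P-shift)

      V∈ : 𝓜^ (stage (suc J)) V
      V∈ = runVar-𝓜^ (suc J) (stage-< J) t

      Z∈ : 𝓜^ (suc (stage J)) (Z J)
      Z∈ = proj₁ (Z-shift J)

      lineMap∈ : 𝓜^ n lineMap
      lineMap∈ = 𝓜^-∘ (𝓜^-weaken (n≤stage (suc J)) V∈)
        (𝓜^-∘ (𝓜^-weaken (m≤n⇒m≤1+n (n≤stage J)) Z∈) (proj₁ P-shift))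

      lineMap-rich : Rich lineMap (suc n)
      lineMap-rich = rich-∘ˡ (proj₁ V∈) (rich-∘ (proj₁ Z∈) P∈
        (trans (shift-lev-suc P-shift) (cong suc (sym (shift-lev P-shift))))
        (subst (Tight P) (cong suc (+-comm n 1)) (tight-shift P-shift 1))
        (subst (Rich (Z J)) (sym (shift-lev-suc P-shift)) (Z-rich J)))

      -- `Z J` and `V` fix the levels up to `stage J`, which is where the prefix sends level n.
      -- Through this the line map itself inherits the property from the prefix.
      lineMap-prefix : lineMap ≈[ suc n ] run 0 u ∘ H
      lineMap-prefix x (s≤s x≤) =
        trans (cong V (proj₂ Z∈ (P x) (s≤s Px≤))) (proj₂ V∈ (P x) (≤-<-trans Px≤ (stage-< J)))
        where
        Px≤ : ℓ (P x) ≤ stage J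
        Px≤ = subst₂ _≤_ (sym (ℓ-lev P∈ x)) (shift-lev P-shift) (lev-≤ P∈ x≤)

      module _ (x : Fin M) (x<n : toℕ x < n) where

        x<J : toℕ x < stage J
        x<J = letter< J x

        variable-letter : ∀ {y} → ℓ y ≡ n → SameLetter (stage J) (toℕ x) (add J x<J (P y))
        variable-letter {y} ℓy with p̄ , c , has ← ∃Has (P y) (subst (toℕ x <_) (sym (trans (ℓ-lev′ P∈ ℓy) (shift-lev P-shift))) x<J) =
          p̄ , c , (P y , copy x<J (P y) , ℓPy , letter , 𝓜^-≼ Z∈ (≤-reflexive (trans (𝒮-levels letter) (cong suc ℓPy))))
                , Has-≼ has (𝓜^-≼ (proj₁ (add-shift J x<J)) (≤-reflexive ℓPy))
          where
          ℓPy = trans (ℓ-lev′ P∈ ℓy) (shift-lev P-shift)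
          letter = copy-𝒮 x<J has ℓPy

        -- Copying level x may be done after `P` instead of before it, so the first variable becomes
        -- the letter x, stored at level `stage J`. Every later variable repeats level `stage J`,
        -- hence x.
        lineMap-at : ∀ y → ℓ y ≡ n → lineMap (copy x<n y) ≡ run 0 ((u ∙ t) ⟨ x ⟩) (H y)
        lineMap-at y ℓy = begin
          V (Z J (P (copy x<n y)))                  ≡⟨ cong (V ∘ Z J) (shift-copy x<n x<J P-shift y (s≤s (≤-reflexive ℓy))) ⟩
          V (Z J (copy x<J (P y)))                  ≡⟨ runVar-≡ (suc J) (stage-< J) t ℓb (variable-letter ℓy) ⟩
          run (suc J) (t [ x ]) (add J x<J (P y))   ≡⟨ cong (λ f → f (H y)) (run-++ 0 u (x ∷ t [ x ])) ⟨
          run 0 ((u ∙ t) ⟨ x ⟩) (H y)               ∎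
          where
          open ≡-Reasoning
          ℓb : ℓ (add J x<J (P y)) ≡ stage (suc J)
          ℓb = trans (ℓ-lev′ (proj₁ (proj₁ (add-shift J x<J))) (trans (ℓ-lev′ P∈ ℓy) (shift-lev P-shift))) (shift-lev (add-shift J x<J))

        lineMap-letter : lineMap ∘ copy x<n ≈[ suc n ] run 0 ((u ∙ t) ⟨ x ⟩) ∘ H
        lineMap-letter = ≈-suc {F = lineMap ∘ copy x<n} {run 0 ((u ∙ t) ⟨ x ⟩) ∘ H}
          (λ y y<n → trans (proj₂ (𝓜^-∘ lineMap∈ (proj₁ (copy-shift x<n))) y y<n)
            (sym (proj₂ (𝓜^-∘ (𝓜^-weaken (n≤stage 0) (proj₁ (run-shift 0 ((u ∙ t) ⟨ x ⟩)))) (proj₁ H-shift)) y y<n)))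
          lineMap-at

  -- From a stopped line to a one-step configuration

  module _ {n Q} (local : Local n Q) {k j} (k∈ : 𝓜^ n k)
           (hits : ∀ {K} → 𝓜^ (n + j) K → ∃[ e ] 𝓜^ n e × lev e n ≡ n + j × Q (k ∘ K ∘ e)) where

    -- `stage 0` is then n + j, so `run 0 w` fixes the levels below n + j and `hits` applies to it.
    open WordMaps (n + j)

    word∈ : ∀ w → 𝓜 (k ∘ run 0 w)
    word∈ w = M1-∘ (proj₁ k∈) (proj₁ (proj₁ (run-shift 0 w)))

    opaque
      shifts : Σ[ Hs ∈ List (T → T) ] (∀ {H} → H ∈ Hs → Shift n (n + j) H) ×
                 (∀ w → ∃[ H ] H ∈ Hs × Q (k ∘ run 0 w ∘ H))
      shifts
        with Hs , Hs-shift , rep ← levelRepresentatives {q = m} (λ {P} → dec em P) n (n + j) (Shift n (n + j))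
               (λ H-sh → proj₁ (proj₁ H-sh) , ≤-reflexive (shift-lev H-sh)) =
        Hs , Hs-shift , λ w →
          let e , e∈ , e-lev , Qe = hits (proj₁ (run-shift 0 w))
              H , H-sh , e≈H = 𝓜^⇒shift e∈
              H-sh′ = subst (λ l → Shift n l H) e-lev H-sh
              H′ , H′∈Hs , H≈H′ = rep H-sh′
          in H′ , H′∈Hs , local (M1-∘ (word∈ w) (proj₁ e∈)) (M1-∘ (word∈ w) (proj₁ (proj₁ (Hs-shift H′∈Hs))))
               (≈-∘ˡ {F = e} (k ∘ run 0 w) (≈-trans {F = e} e≈H H≈H′)) Qe

    Hs : List (T → T)
    Hs = proj₁ shifts

    colour : List (Fin (n + j)) → Fin (length Hs)
    colour w = Any.index (proj₁ (proj₂ (proj₂ (proj₂ shifts) w)))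

    Q-colour : ∀ w {i} → colour w ≡ i → Q (k ∘ run 0 w ∘ lookup Hs i)
    Q-colour w refl = subst (λ H → Q (k ∘ run 0 w ∘ H)) (lookup-index (proj₁ (proj₂ (proj₂ (proj₂ shifts) w))))
      (proj₂ (proj₂ (proj₂ (proj₂ shifts) w)))

    configuration : ∃[ G ] 𝓜^ n G × Rich G (suc n) × Q G × (∀ {i} (i<n : i < n) → Q (G ∘ copy i<n))
    configuration with u ∙ t , stopped ← stoppedLine colour =
      k ∘ lineMap , G∈ , rich-∘ˡ (proj₁ k∈) lineMap-rich
      , local (M1-∘ (word∈ u) (proj₁ (proj₁ H-shift))) (proj₁ G∈)
          (≈-∘ˡ {F = run 0 u ∘ H} k (≈-sym {F = lineMap} lineMap-prefix)) (Q-colour u refl)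
      , λ i<n → cast (toℕ-fromℕ< (<-≤-trans i<n (m≤m+n n j))) i<n (QGx (fromℕ< (<-≤-trans i<n (m≤m+n n j))))
      where
      H : T → T
      H = lookup Hs (colour u)
      H-shift : Shift n (n + j) H
      H-shift = proj₁ (proj₂ shifts) (∈-lookup (colour u))
      open LineMap H-shift u t
      G∈ : 𝓜^ n (k ∘ lineMap)
      G∈ = 𝓜^-∘ k∈ lineMap∈
      QGx : ∀ x (x<n : toℕ x < n) → Q (k ∘ lineMap ∘ copy x<n)
      QGx x x<n = local (M1-∘ (word∈ ((u ∙ t) ⟨ x ⟩)) (proj₁ (proj₁ H-shift))) (M1-∘ (proj₁ G∈) (proj₁ (proj₁ (copy-shift x<n))))
        (≈-∘ˡ {F = run 0 ((u ∙ t) ⟨ x ⟩) ∘ H} k (≈-sym {F = lineMap ∘ copy x<n} (lineMap-letter x x<n)))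
        (Q-colour ((u ∙ t) ⟨ x ⟩) (stopped x))
      cast : ∀ {i i′} → i′ ≡ i → (i<n : i < n) → ((i′<n : i′ < n) → Q (k ∘ lineMap ∘ copy i′<n)) → Q (k ∘ lineMap ∘ copy i<n)
      cast refl i<n Qi = Qi i<n

  noConfiguration⇒⊥ : ∀ {n Q} → Local n Q → Large n Q → ¬ NoConfiguration n Q
  noConfiguration⇒⊥ local large noConf =
    let k , k∈ , j , hits = syndetic local large
        G , G∈ , rich , QG , QGc = configuration local k∈ hits
    in noConf G∈ rich QG QGc

  splits : ∀ {n Q} → Local n Q → Large n Q → ∃[ k ] ∃[ G ] Splits n Q k G
  splits {n} {Q} local large = decidable-stable (dec em (∃[ k ] ∃[ G ] Splits n Q k G)) λ none →
    let F , F∈ , noConf = noConfiguration local (λ sp → none (_ , _ , sp)) in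
    noConfiguration⇒⊥ {n} {λ h → Q (F ∘ h)}
      (λ {G} G∈ H∈ G≈H → local (M1-∘ (proj₁ F∈) G∈) (M1-∘ (proj₁ F∈) H∈) (≈-∘ˡ {F = G} F G≈H))
      (λ K∈ → large (𝓜^-∘ F∈ K∈)) noConf

  -- The pigeonhole principle and its iteration

  MapColouring : ℕ → ℕ → Set _
  MapColouring n r = ∀ {F} → 𝓜^ n F → Fin r

  -- A `MapColouring` also receives the membership proof; for equal `F` and `G` this says that the
  -- proof does not affect the colour.
  DependsBelow : ∀ {n r} → ℕ → MapColouring n r → Set _
  DependsBelow {n} N κ = ∀ {F G} (F∈ : 𝓜^ n F) (G∈ : 𝓜^ n G) → F ≈[ N ] G → κ F∈ ≡ κ G∈

  𝓜^-≈ : ∀ {n N F G} → n ≤ N → F ≈[ N ] G → 𝓜^ n F → 𝓜 G → 𝓜^ n G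
  𝓜^-≈ {F = F} {G} n≤N F≈G (_ , F≈) G∈ = G∈ , ≈-trans {F = G} (≈-sym {F = F} (≈-weaken {F = F} n≤N F≈G)) F≈

  floor-𝓜^ : ∀ {n g} → 𝓜^ n g → floor g n ≤ n
  floor-𝓜^ {n} {g} g∈ = subst (_≤ n) (floor-≈ {n} {id} {g} (≈-sym {F = g} (proj₂ g∈)))
    (≤-trans (≤-reflexive (sym (tight-id n))) (≤-reflexive (lev-id n)))

  tight-≈ : ∀ {n F G} → F ≈[ suc n ] G → Tight F n → Tight G n
  tight-≈ {n} {F} {G} F≈G tight = trans (sym (lev-≈ F≈G ≤-refl))
    (trans tight (floor-≈ {n} {F} {G} (≈-weaken {F = F} (n≤1+n n) F≈G)))

  tighten₂ : ∀ {F} → 𝓜 F → ∀ n → ∃[ F′ ] 𝓜 F′ × F′ ≈[ n ] F × Tight F′ n × Tight F′ (suc n)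
  tighten₂ {F} F∈ n
    with F₁ , _ , F₁∈ , tight₁ , F₁≈F , _ ← tighten F∈ n
    with F₂ , _ , F₂∈ , tight₂ , F₂≈F₁ , _ ← tighten F₁∈ (suc n) =
    F₂ , F₂∈ , ≈-trans {F = F₂} (≈-weaken {F = F₂} (n≤1+n n) F₂≈F₁) F₁≈F , tight-≈ (≈-sym {F = F₂} F₂≈F₁) tight₁ , tight₂

  sequenceLimit : ∀ {n} (F : ℕ → T → T) → (∀ j → 𝓜^ n (F j)) → (∀ j → F (suc j) ≈[ j + n ] F j) →
    ∃[ F∞ ] 𝓜^ n F∞ × (∀ j → F∞ ≈[ suc (j + n) ] F (suc j))
  sequenceLimit {n} F F∈ F-suc
    -- `F i` is settled only below level i + n, which for n = 0 excludes level i; `F (suc i)` is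
    -- settled at level i too.
    with F∞ , F∞∈ , F∞≡ ← M1-limit (λ i → F (suc i)) (λ i → proj₁ (F∈ (suc i)))
           (λ i x x≤ → sym (F-suc (suc i) x (s≤s (≤-trans x≤ (m≤m+n i n))))) =
    F∞ , (F∞∈ , λ x x<n → trans (F∞≡ (ℓ x) x ≤-refl) (proj₂ (F∈ (suc (ℓ x))) x x<n))
    , λ { j x (s≤s x≤) → trans (F∞≡ (n + j) x (≤-trans x≤ (≤-reflexive (+-comm j n))))
          (trans (cong (λ i → F i x) (sym (+-suc n j))) (stable n (suc j) x (s≤s x≤))) }
    where
    stable : ∀ d j → F (d + j) ≈[ j + n ] F j
    stable zero    j x x< = refl
    stable (suc d) j x x< = trans (F-suc (d + j) x (<-≤-trans x< (+-monoˡ-≤ n (m≤n+m j d)))) (stable d j x x<)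

  module OneLevel {n r} (κ : MapColouring n r) (κ-local : DependsBelow (suc n) κ) where

    _HasColour_ : (T → T) → Fin r → Set _
    F HasColour c = Σ[ F∈ ∈ 𝓜^ n F ] κ F∈ ≡ c

    hasColour-≈ : ∀ {c F G} → 𝓜 G → F ≈[ suc n ] G → F HasColour c → G HasColour c
    hasColour-≈ G∈ F≈G (F∈ , eq) = 𝓜^-≈ (n≤1+n n) F≈G F∈ G∈ ,
      trans (sym (κ-local F∈ (𝓜^-≈ (n≤1+n n) F≈G F∈ G∈) F≈G)) eq

    -- Colours that are not large are excluded one after another, each at the cost of one more map
    -- composed into `k`. Some colour survives, since every h receives one.
    largeColour : ∀ {μ f} → n ≤ μ → 𝓜^ n f →
      ∃[ c ] ∃[ k ] 𝓜^ μ k × Large μ (λ h → (k ∘ h ∘ f) HasColour c)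
    largeColour {μ} {f} n≤μ f∈ = go (allFin r) 𝓜^-id λ h∈ →
      _ , ∈-allFin _ , 𝓜^-∘ (𝓜^-weaken n≤μ h∈) f∈ , refl
      where
      go : ∀ cs {k} → 𝓜^ μ k → (∀ {h} → 𝓜^ μ h → ∃[ c ] c ∈ cs × (k ∘ h ∘ f) HasColour c) →
           ∃[ c ] ∃[ k ] 𝓜^ μ k × Large μ (λ h → (k ∘ h ∘ f) HasColour c)
      go []       k∈ all with _ , () , _ ← all 𝓜^-id
      go (c ∷ cs) {k} k∈ all with dec em (Large μ (λ h → (k ∘ h ∘ f) HasColour c))
      ... | yes large  = c , k , k∈ , large
      ... | no ¬lg with K , K∈ , avoids ← ¬large {Q = λ h → (k ∘ h ∘ f) HasColour c} ¬lg =
        go cs (𝓜^-∘ k∈ K∈) λ h∈ → case all (𝓜^-∘ K∈ h∈) of λ where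
          (_ , here refl , col)  → ⊥-elim (avoids h∈ col)
          (c′ , there c′∈ , col) → c′ , c′∈ , col

    module _ (c : Fin r) where

      Through : ℕ → (T → T) → Set _
      Through ν F = ∀ {g} → 𝓜^ n g → lev g n ≡ ν → (F ∘ g) HasColour c

      through-≈ : ∀ {ν F G} → 𝓜 G → F ≈[ suc ν ] G → Through ν F → Through ν G
      through-≈ {F = F} {G} G∈ F≈G thr g∈ g-lev = hasColour-≈ (M1-∘ G∈ (proj₁ g∈))
        (≈-∘ʳ-suc {F = F} {G} (proj₁ g∈) (≤-reflexive g-lev) F≈G) (thr g∈ g-lev)

      -- `k ∘ f` is the current approximation, final below level ν. Largeness concerns maps inserted
      -- between `k` and `f`: `f` carries the richness and tightness that turn one-step moves into
      -- copies, and `k` collects the maps chosen to keep the set large.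
      record State (ν : ℕ) : Set (a ⊔ o ⊔ s ⊔ m) where
        field
          k f    : T → T
          k∈     : 𝓜^ n k
          f∈     : 𝓜^ n f
          tight₁ : Tight f (suc ν)
          tight₂ : Tight f (suc (suc ν))
          rich   : Rich f ν
          large  : Large (lev f ν) (λ h → Through ν (k ∘ h ∘ f))

        current : T → T
        current = k ∘ f

      -- A map sending level n to level ν + 1 first makes one step above ν.
      through-suc : ∀ {ν F f} → n ≤ ν → 𝓜 F → 𝓜 f → Rich f ν → Tight f (suc ν) →
        (∀ {i} (i< : i < lev f ν) → Through ν (F ∘ copy i< ∘ f)) → Through (suc ν) (F ∘ f)
      through-suc {ν} {F} {f} n≤ν F∈ f∈ f-rich tight thr {g} g∈ g-lev
        with g₀ , y , g₀∈ , y-sh , g₀≈g , g₀-lev , g≈ ← lower-one (proj₁ g∈) g-lev (≤-trans (floor-𝓜^ g∈) n≤ν)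
        with i , i< , fy≈ ← rich-copy f∈ f-rich tight (proj₁ y-sh , shift-lev y-sh) =
        hasColour-≈ (M1-∘ (M1-∘ F∈ f∈) (proj₁ g∈))
          (λ x x≤n → cong F (sym (trans (cong f (g≈ x x≤n)) (fy≈ (g₀ x) (≤-trans (ℓ<⇒ℓF<suc x≤n) (s≤s (≤-reflexive g₀-lev)))))))
          (thr i< (𝓜^-≈ ≤-refl (≈-sym {F = g₀} g₀≈g) g∈ g₀∈) g₀-lev)
        where
        ℓ<⇒ℓF<suc : ∀ {x} → ℓ x < suc n → ℓ (g₀ x) < suc (lev g₀ n)
        ℓ<⇒ℓF<suc {x} (s≤s x≤) = s≤s (subst (_≤ lev g₀ n) (sym (ℓ-lev g₀∈ x)) (lev-≤ g₀∈ x≤))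

      Continues : ∀ {ν} → State ν → State (suc ν) → Set _
      Continues {ν} st st′ = State.current st′ ≈[ ν ] State.current st × Through ν (State.current st′)

      opaque
        next : ∀ {ν} → n ≤ ν → (st : State ν) → ∃[ st′ ] Continues st st′
        next {ν} n≤ν st = extend (splits {Q = λ h → Through ν (k ∘ h ∘ f)} Q-local large)
          where
          open State st
          f∈𝓜 : 𝓜 f
          f∈𝓜 = proj₁ f∈
          Q-local : Local (lev f ν) (λ h → Through ν (k ∘ h ∘ f))
          Q-local {h} {h′} h∈ h′∈ h≈h′ = through-≈ (M1-∘ (proj₁ k∈) (M1-∘ h′∈ f∈𝓜))
            (≈-∘ˡ {F = h ∘ f} k (≈-∘ʳ-suc {F = h} {h′} f∈𝓜 ≤-refl h≈h′))
          extend : ∃[ k′ ] ∃[ G ] Splits (lev f ν) (λ h → Through ν (k ∘ h ∘ f)) k′ G → ∃[ st′ ] Continues st st′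
          extend (k′ , G , k′∈ , G∈ , G-rich , thr , G-large)
            -- `G ∘ f` is altered only from level ν + 2 on, above everything that colours and
            -- richness at ν + 1 depend on.
            with f′ , f′∈ , f′≈ , tight₁′ , tight₂′ ← tighten₂ (M1-∘ (proj₁ G∈) f∈𝓜) (suc (suc ν)) =
            record
              { k      = k ∘ k′
              ; f      = f′
              ; k∈     = 𝓜^-∘ k∈ (𝓜^-weaken n≤μ k′∈)
              ; f∈     = 𝓜^-≈ (m≤n⇒m≤1+n (m≤n⇒m≤1+n n≤ν)) (≈-sym {F = f′} f′≈) (𝓜^-∘ (𝓜^-weaken n≤μ G∈) f∈) f′∈
              ; tight₁ = tight₁′
              ; tight₂ = tight₂′
              ; rich   = rich-≈ (≈-sym {F = f′} f′≈)
                  (rich-∘ (proj₁ G∈) f∈𝓜 tight₁ tight₂ (subst (Rich G) (sym tight₁) G-rich))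
              ; large  = large′
              }
            , (λ x x<ν → cong k (trans (cong k′ (trans (f′≈ x (m<n⇒m<1+n (m<n⇒m<1+n x<ν))) (proj₂ G∈ (f x) (ℓ<⇒ℓF< f∈𝓜 x<ν))))
                                       (proj₂ k′∈ (f x) (ℓ<⇒ℓF< f∈𝓜 x<ν))))
            , through-≈ (M1-∘ (proj₁ k∈) (M1-∘ (proj₁ k′∈) f′∈))
                (≈-∘ˡ {F = G ∘ f} (k ∘ k′) (≈-weaken {F = G ∘ f} (n≤1+n _) (≈-sym {F = f′} f′≈))) thr
            where
            n≤μ : n ≤ lev f ν
            n≤μ = ≤-trans n≤ν (≤lev f∈𝓜 ν)
            μ≡ : lev f′ (suc ν) ≡ lev G (suc (lev f ν))
            μ≡ = trans (lev-≈ f′≈ ≤-refl) (trans (lev-∘ (proj₁ G∈) f (suc ν)) (cong (lev G) tight₁))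
            large′ : Large (lev f′ (suc ν)) (λ h → Through (suc ν) ((k ∘ k′) ∘ h ∘ f′))
            large′ {K} K∈ with h , h∈ , thr-h ← G-large (𝓜^-weaken (≤-reflexive (sym μ≡)) K∈) =
              h , 𝓜^-weaken (≤-reflexive μ≡) h∈
              , through-≈ (M1-∘ F∈ f′∈) (≈-∘ˡ {F = G ∘ f} F (≈-sym {F = f′} f′≈))
                  (through-suc {F = F ∘ G} n≤ν (M1-∘ F∈ (proj₁ G∈)) f∈𝓜 rich tight₁ thr-h)
              where
              F : T → T
              F = k ∘ k′ ∘ K ∘ h
              F∈ : 𝓜 F
              F∈ = M1-∘ (proj₁ k∈) (M1-∘ (proj₁ k′∈) (M1-∘ (proj₁ K∈) (proj₁ h∈)))

      limit : State n → ∃[ F ] 𝓜^ n F × (∀ {g} → 𝓜^ n g → (F ∘ g) HasColour c)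
      limit start =
        let F∞ , F∞∈ , F∞≈ = sequenceLimit (λ j → State.current (state j))
              (λ j → 𝓜^-∘ (State.k∈ (state j)) (State.f∈ (state j)))
              (λ j → proj₁ (proj₂ (next (m≤n+m n j) (state j))))
        in F∞ , F∞∈ , λ g∈ →
          let j , n+j≡ = m≤n⇒∃[o]m+o≡n (≤lev (proj₁ g∈) n) in
          through-≈ {j + n} (proj₁ F∞∈) (≈-sym {F = F∞} (F∞≈ j)) (proj₂ (proj₂ (next (m≤n+m n j) (state j))))
            g∈ (trans (sym n+j≡) (+-comm n j))
        where
        state : ∀ j → State (j + n)
        state zero    = start
        state (suc j) = proj₁ (next (m≤n+m n j) (state j))

    opaque
      pigeonhole : ∃[ F ] 𝓜^ n F × ∃[ c ] (∀ {g} → 𝓜^ n g → (F ∘ g) HasColour c)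
      pigeonhole
        with n′ , E , E-sh@(E∈ , _) , E-rich ← ∃rich n
        with c , k , k∈ , large ← largeColour (≤-trans (shift-≤ E-sh) (≤-reflexive (sym (shift-lev E-sh)))) E∈ =
        let F , F∈ , coloured = limit c record
              { k      = k
              ; f      = E
              ; k∈     = 𝓜^-weaken (≤-trans (shift-≤ E-sh) (≤-reflexive (sym (shift-lev E-sh)))) k∈
              ; f∈     = E∈
              ; tight₁ = trans (shift-lev-suc E-sh) (cong suc (sym (shift-lev E-sh)))
              ; tight₂ = subst (Tight E) (cong suc (+-comm n 1)) (tight-shift E-sh 1)
              ; rich   = E-rich
              ; large  = λ {K} K∈ → let h , h∈ , col = large K∈ in
                  -- A g in `𝓜^ n` with `lev g n` = n fixes all levels up to n, so at the start
                  -- `Through n` concerns a single colour.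
                  h , h∈ , λ {g} g∈ g-lev → hasColour-≈
                    (M1-∘ (proj₁ k∈) (M1-∘ (proj₁ K∈) (M1-∘ (proj₁ h∈) (M1-∘ (proj₁ E∈) (proj₁ g∈)))))
                    (≈-∘ˡ {F = id} (k ∘ K ∘ h ∘ E) (tight-unique M1-id (proj₁ g∈) (tight-id n) (≈-sym {F = g} (proj₂ g∈)) (trans (lev-id n) (sym g-lev))))
                    col
              }
        in F , F∈ , c , coloured

  module Reduction (n k : ℕ) {r} (κ : MapColouring n r) (κ-local : DependsBelow (n + suc k) κ) where

    N : ℕ
    N = n + k

    κ-≈ : DependsBelow (suc N) κ
    κ-≈ {F} {G} F∈ G∈ F≈G = κ-local F∈ G∈ (subst (λ N → F ≈[ N ] G) (sym (+-suc n k)) F≈G)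
    n≤N : n ≤ N
    n≤N = m≤m+n n k

    At : ℕ → (T → T) → Set _
    At j f = 𝓜^ n f × Tight f N × lev f N ≡ n + j
    -- For f in `At j`, n + j is the level to which f sends N. By tightness the maps `h ∘ f` are, up
    -- to level N, all the extensions of f from below N, and none of them may change the colour.
    Decided₁ : ℕ → (T → T) → (T → T) → Set _
    Decided₁ j f F = (F∈ : 𝓜^ n F) (f∈ : 𝓜^ n f) → ∀ {h} (h∈ : 𝓜^ (n + j) h) →
      κ (𝓜^-∘ F∈ (𝓜^-∘ (𝓜^-weaken (m≤m+n n j) h∈) f∈)) ≡ κ (𝓜^-∘ F∈ f∈)
    Decided : ℕ → (T → T) → Set _
    Decided j F = ∀ {f} → At j f → Decided₁ j f F

    resp : ∀ {j F G} → F ≗ G → Decided j F → Decided j G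
    resp F≗G dec-F at G∈ f∈ h∈ = trans (κ-≈ _ _ (λ x _ → sym (F≗G _))) (trans (dec-F at F∈ f∈ h∈) (κ-≈ _ _ (λ x _ → F≗G _)))
      where F∈ = 𝓜-resp-≗ (λ x → sym (F≗G x)) (proj₁ G∈) , λ x x< → trans (F≗G x) (proj₂ G∈ x x<)

    -- With f fixed, the colour of `F ∘ h ∘ f` depends on h up to level n + j alone, so it is a
    -- one-level colouring of `𝓜^ (n + j)`.
    dense₁ : ∀ {j f} → At j f → ∀ {F} → 𝓜^ n F →
      ∃[ K ] 𝓜^ (n + j) K × (∀ {G} → 𝓜^ (n + j) G → Decided₁ j f (F ∘ K ∘ G))
    dense₁ {j} {f} (f∈ , _ , f-lev) {F} F∈ = result (OneLevel.pigeonhole κ′ κ′-local)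
      where
      κ′ : MapColouring (n + j) r
      κ′ h∈ = κ (𝓜^-∘ F∈ (𝓜^-∘ (𝓜^-weaken (m≤m+n n j) h∈) f∈))
      κ′-local : DependsBelow (suc (n + j)) κ′
      κ′-local {h} {h′} h∈ h′∈ h≈h′ = κ-≈ _ _ (≈-∘ˡ {F = h ∘ f} F (≈-∘ʳ-suc {F = h} {h′} (proj₁ f∈) (≤-reflexive f-lev) h≈h′))
      open OneLevel κ′ κ′-local using (_HasColour_)
      result : (∃[ K ] 𝓜^ (n + j) K × ∃[ c ] (∀ {g} → 𝓜^ (n + j) g → (K ∘ g) HasColour c)) →
        ∃[ K ] 𝓜^ (n + j) K × (∀ {G} → 𝓜^ (n + j) G → Decided₁ j f (F ∘ K ∘ G))
      result (K , K∈ , c , mono) = K , K∈ , λ G∈ FKG∈ f∈′ h∈ →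
        trans (κ-≈ _ _ (λ _ _ → refl)) (trans (proj₂ (mono (𝓜^-∘ G∈ h∈)))
          (trans (sym (proj₂ (mono G∈))) (κ-≈ _ _ (λ _ _ → refl))))

    dense : ∀ j {F} → 𝓜^ n F → ∃[ K ] 𝓜^ (n + j) K × (∀ {G} → 𝓜^ (n + suc j) G → Decided j (F ∘ K ∘ G))
    dense j {F} F∈
      with fs , at , rep ← levelRepresentatives {q = m} (λ {P} → dec em P) N (n + j) (At j) (λ ((f∈ , _) , _ , f-lev) → f∈ , ≤-reflexive f-lev)
      with K , K∈ , decided ← dense-All (Decided₁ j) fs (m≤m+n n j) (dense₁ {j} ∘ at) F∈ =
      K , K∈ , λ {G} G∈ {f} f-at FKG∈ f∈ {h} h∈ →
        let f′ , f′∈fs , f≈f′ = rep f-at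
            f′∈ = proj₁ (at f′∈fs)
        in trans (κ-≈ _ _ (≈-∘ˡ {F = f} (F ∘ K ∘ G ∘ h) f≈f′))
             (trans (decided (𝓜^-weaken (+-monoʳ-≤ n (n≤1+n j)) G∈) f′∈fs FKG∈ f′∈ h∈)
                    (κ-≈ _ _ (≈-∘ˡ {F = f′} (F ∘ K ∘ G) (≈-sym {F = f} f≈f′))))

    -- Up to level N, g is `H ∘ f` with f tight, so `F ∘ g` has the colour of `F ∘ f`; and f up to
    -- level N is determined by g below N.
    drop : ∀ {F} (F∈ : 𝓜^ n F) → (∀ j → Decided j F) → DependsBelow N (λ g∈ → κ (𝓜^-∘ F∈ g∈))
    drop {F} F∈ decided {g} {h} g∈ h∈ g≈h =
      case tight-part g∈ of λ (f , f∈ , f-tight , f≈g , κ≡) →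
      case tight-part h∈ of λ (f′ , f′∈ , f′-tight , f′≈h , κ≡′) →
      let f≈f′ : f ≈[ N ] f′
          f≈f′ = ≈-trans {F = f} f≈g (≈-trans {F = g} g≈h (≈-sym {F = f′} f′≈h))
          lev≡ : lev f N ≡ lev f′ N
          lev≡ = trans f-tight (trans (floor-≈ {N} {f} {f′} f≈f′) (sym f′-tight))
      in trans κ≡ (trans (κ-≈ _ _ (≈-∘ˡ {F = f} F (tight-unique (proj₁ f∈) (proj₁ f′∈) f-tight f≈f′ lev≡))) (sym κ≡′))
      where
      tight-part : ∀ {g} (g∈ : 𝓜^ n g) → ∃[ f ] Σ[ f∈ ∈ 𝓜^ n f ] Tight f N × f ≈[ N ] g × κ (𝓜^-∘ F∈ g∈) ≡ κ (𝓜^-∘ F∈ f∈)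
      tight-part {g} g∈
        with f , H , f∈𝓜 , f-tight , f≈g , H-sh , g≈Hf ← tighten (proj₁ g∈) N
        with j , n+j≡ ← m≤n⇒∃[o]m+o≡n (≤-trans n≤N (≤lev f∈𝓜 N)) =
        f , f∈ , f-tight , f≈g
        , trans (κ-≈ _ _ (≈-∘ˡ {F = g} F g≈Hf)) (decided j (f∈ , f-tight , sym n+j≡) F∈ f∈ (𝓜^-weaken (≤-reflexive n+j≡) (proj₁ H-sh)))
        where
        f∈ : 𝓜^ n f
        f∈ = 𝓜^-≈ n≤N (≈-sym {F = f} f≈g) g∈ f∈𝓜

    reduction : ∃[ F ] Σ[ F∈ ∈ 𝓜^ n F ] DependsBelow N (λ g∈ → κ (𝓜^-∘ F∈ g∈))
    reduction = let F , F∈ , decided = fusion n Decided (λ {j} → resp {j}) dense in F , F∈ , drop F∈ decided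

  ramsey : ∀ n k {r} (κ : MapColouring n r) → DependsBelow (n + k) κ →
           ∃[ F ] Σ[ F∈ ∈ 𝓜^ n F ] (∀ {g h} (g∈ : 𝓜^ n g) (h∈ : 𝓜^ n h) → κ (𝓜^-∘ F∈ g∈) ≡ κ (𝓜^-∘ F∈ h∈))
  ramsey n zero    κ κ-local = id , 𝓜^-id , λ {g} {h} g∈ h∈ →
    κ-local _ _ (subst (λ N → g ≈[ N ] h) (sym (+-identityʳ n)) (≈-trans {F = g} (proj₂ g∈) (≈-sym {F = h} (proj₂ h∈))))
  ramsey n (suc k) {r} κ κ-local =
    let F , F∈ , local = Reduction.reduction n k κ κ-local
        F′ , F′∈ , const = ramsey n k (λ g∈ → κ (𝓜^-∘ F∈ g∈)) local
    in F ∘ F′ , 𝓜^-∘ F∈ F′∈ , λ g∈ h∈ →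
       trans (κ-local _ _ (λ _ _ → refl)) (trans (const g∈ h∈) (κ-local _ _ (λ _ _ → refl)))

mainTheorem1 : ∀ {a o s m} → ExcludedMiddle (a ⊔ o ⊔ s ⊔ m) →
    (𝕋 : SMTree a o s m) → let open SMTree 𝕋 in
    (n k r : ℕ) (χ : Colouring n k r) →
    Σ[ F ∈ (T → T) ] Σ[ F∈𝓜ⁿ ∈ 𝓜^ n F ]
    ((g h : Setoid.Carrier (𝓐𝓜 n k)) →
    Func.to χ (compose {n} {k} F∈𝓜ⁿ g) ≡ Func.to χ (compose {n} {k} F∈𝓜ⁿ h))
mainTheorem1 em 𝕋 n k r χ
  -- A member of `𝓜^ n` is coloured through its restriction; any element of `𝓐𝓜 n k` equals the
  -- restriction of its witness in the setoid, which `χ` respects.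
  with F , F∈ , constant ← Ramsey.ramsey 𝕋 em n k
         (λ {G} G∈ → Func.to χ ((λ x → G (proj₁ x)) , G , G∈ , λ _ → refl))
         (λ _ _ G≈H → Func.cong χ (λ (x , x<) → G≈H x x<)) =
  F , F∈ , λ (g , G , G∈ , g≡G) (h , H , H∈ , h≡H) →
    trans (Func.cong χ (λ x → cong F (g≡G x)))
      (trans (constant G∈ H∈) (sym (Func.cong χ (λ x → cong F (h≡H x)))))
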